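{- Let $m\in\{0,1\}$. Then \[ \lim_{X\to+\infty}\frac{\#\{n\le X:\ \mathcal{J}^*_6(3^m(8n+1))\equiv 0 \pmod 2\}}{X}=1, \] where $n$ ranges over positive integers.
   Context: Let $q=e^{2\pi i\tau}$ with $\tau$ in the upper half-plane, and let $\eta(\tau)=q^{1/24}\prod_{n\ge1}(1-q^n)$ be the Dedekind eta function. The Hauptmodul of the Fricke group $\Gamma_0^*(6)$ is \[ j_6^*(\tau)=\left(\frac{\eta(\tau)\eta(3\tau)}{\eta(2\tau)\eta(6\tau)}\right)^6+6+2^6\left(\frac{\eta(2\tau)\eta(6\tau)}{\eta(\tau)\eta(3\tau)}\right)^6=\frac1q+\sum_{n\ge1}\mathcal{J}^*_6(n)q^n, \] and $\mathcal{J}^*_6(n)$ denotes its $n$-th Fourier coefficient (an integer). -}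

module Defs where

open import Data.Nat as ℕ using (ℕ; zero; suc; _∸_; _≤_)
open import Data.Nat.Divisibility as ℕD using ()
open import Data.Integer using (ℤ; +_; -_; ∣_∣) renaming (_+_ to _+ℤ_; _*_ to _*ℤ_)
open import Data.List using (List; length; filter; map; upTo)
open import Relation.Nullary using (does; yes; no)
open import Data.Bool using (true; false)

Series : Set
Series = ℕ → ℤ

sumTo : ℕ → (ℕ → ℤ) → ℤ
sumTo zero    f = f 0
sumTo (suc n) f = sumTo n f +ℤ f (suc n)

_⊛_ : Series → Series → Series
(f ⊛ g) n = sumTo n (λ k → f k *ℤ g (n ∸ k))

oneS : Series
oneS zero    = + 1
oneS (suc _) = + 0

-- 1 - q^d   (used with d ≥ 1)
oneMinusQ : ℕ → Series
oneMinusQ d k with k ℕ.≟ 0 | k ℕ.≟ d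
... | yes _ | _     = + 1
... | no _  | yes _ = - (+ 1)
... | no _  | no _  = + 0

-- (1 - q^d)^{-1} = Σ_{j ≥ 0} q^{d j}   (used with d ≥ 1)
geomQ : ℕ → Series
geomQ d k with does (d ℕD.∣? k)
... | true  = + 1
... | false = + 0

powS : Series → ℕ → Series
powS f zero    = oneS
powS f (suc e) = f ⊛ powS f e

prodS : ℕ → (ℕ → Series) → Series
prodS zero    F = oneS
prodS (suc N) F = F (suc N) ⊛ prodS N F

PFactor : ℕ → Series
PFactor n = powS (oneMinusQ n ⊛ (oneMinusQ (3 ℕ.* n) ⊛ (geomQ (2 ℕ.* n) ⊛ geomQ (6 ℕ.* n)))) 6

PinvFactor : ℕ → Series
PinvFactor n = powS (geomQ n ⊛ (geomQ (3 ℕ.* n) ⊛ (oneMinusQ (2 ℕ.* n) ⊛ oneMinusQ (6 ℕ.* n)))) 6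

-- Coefficient of q^k in the infinite products: factors with index n > k
-- are ≡ 1 mod q^{k+1}, so the finite product up to k gives the exact coefficient.
P : Series
P k = prodS k PFactor k

Pinv : Series
Pinv k = prodS k PinvFactor k

-- (η(τ)η(3τ)/(η(2τ)η(6τ)))^6 = q^{-1} P,  64 (η(2τ)η(6τ)/(η(τ)η(3τ)))^6 = 64 q P⁻¹.
-- Hence for n ≥ 1, the q^n coefficient of j₆* is  [q^{n+1}]P + 64 [q^{n-1}]P⁻¹.
J6* : ℕ → ℤ
J6* n = P (suc n) +ℤ (+ 64) *ℤ Pinv (n ∸ 1)

countEven : ℕ → ℕ → ℕ
countEven m X =
  length (filter (λ n → 2 ℕD.∣? ∣ J6* (3 ℕ.^ m ℕ.* (8 ℕ.* n ℕ.+ 1)) ∣)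
                 (map suc (upTo X)))

-- Work in 𝔽₂[[x]], and put f = ∏ (1 + xⁿ), ψ = f³.  Since (1 - x²ⁿ) = (1 - xⁿ)² mod 2, the series P is
-- congruent to (ψ ψ₃)⁻², where ψ₃ = ψ(x³).  Shanks' telescoping sums give f = Σ x^(pentagonal numbers)
-- and ψ = Σ x^(triangular numbers); sorting the triangular numbers modulo 3 then yields
-- ψ = f(x³) + x ψ(x⁹).  Inserting this relation into itself shows that ψ ψ₃ = ψ⁴ + x ψ₃⁴.
-- As squaring is f(x) ↦ f(x²), the last equation exhibits the even and odd parts of γ = (ψ ψ₃)⁻¹, and
-- J₆*(8n + 1) as well as J₆*(3(8n + 1)) turns out to be congruent to the n-th coefficient of ψ:
-- it is odd exactly when n is triangular.
module Submission where

open import Defs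
import Algebra.Solver.Ring as RingSolver
import Data.Bool.Solver as BoolSolver
import Data.Integer.Properties as ℤ
open import Algebra.Bundles using (CommutativeRing)
open import Algebra.Solver.Ring.AlmostCommutativeRing using
    (fromCommutativeRing; _-Raw-AlmostCommutative⟶_; Induced-equivalence)
open import Data.Bool using (Bool; true; false; _∧_; _xor_; not; if_then_else_)
open import Data.Bool.Properties using (xor-assoc; xor-comm; xor-identityʳ; xor-same; ∧-comm; ∧-assoc;
    ∧-distribʳ-xor; xor-∧-commutativeRing; ∧-zeroʳ; ∧-idem; xor-annihilates-not; not-distribˡ-xor;
        not-involutive)
open import Data.Empty using (⊥-elim)
open import Data.Integer as ℤ using (ℤ; -[1+_]; ∣_∣; _⊖_)
open import Data.List using ([]; _∷_; length; filter; map; upTo)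
open import Data.List.Properties using (upTo-∷ʳ; map-++; filter-++; length-++)
open import Data.Maybe using (just; nothing)
open import Data.Nat using (ℕ; zero; suc; _+_; _*_; _≤_; _<_; z≤n; s≤s; z<s; s<s; _∸_; _^_; s≤s⁻¹; _≟_)
open import Data.Nat.Divisibility using (_∣_; _∣?_; ∣m+n∣m⇒∣n; ∣m∣n⇒∣m+n; ∣-refl; >⇒∤; divides)
open import Data.Nat.Properties using (≤-refl; ≤-trans; ≤-reflexive; n<1+n; m≤n⇒m≤1+n; m≤m+n; m≤n+m;
    +-identityʳ; +-comm; m≤n⇒∃[o]m+o≡n; <-≤-trans; ≤-<-trans; _<?_; ≮⇒≥; *-monoˡ-≤; *-monoʳ-≤; +-mono-≤; *-suc;
        +-suc; n≤1+n; m≤n*m; +-monoʳ-≤; ≤-total; *-distribˡ-+; +-cancelˡ-≤; *-cancelˡ-≤; module ≤-Reasoning)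
open import Data.Nat.Tactic.RingSolver using (solve-∀)
open import Data.Product using (_,_; ∃-syntax; _×_)
open import Data.Sum using (inj₁; inj₂)
open import Function.Bundles using (mk⇔)
open import Level using (0ℓ)
open import Relation.Binary.Definitions using (WeaklyDecidable)
open import Relation.Binary.PropositionalEquality using
    (_≡_; refl; sym; trans; cong; cong₂; subst; module ≡-Reasoning; _≢_)
open import Relation.Nullary using (does; yes; no)
open import Relation.Nullary.Decidable using (dec-false; does-⇔)
open import Relation.Unary using (Decidable)

-- Power series over 𝔽₂

-- The modular equation is reached without modular forms. The relation gives f(x³) = ψ(x) + x ψ(x⁹),
-- and the cube of f(x³) is ψ(x³), so ψ(x), ψ(x³) and ψ(x⁹) are tied together algebraically. In
-- characteristic 2, where fourth powers are additive, this tie says that the defect D of the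
-- equation satisfies D(x) = x D(x³), and only the zero series does. Infinite products never enter
-- an argument directly. Each identity is proved for finite products and finite sums, holds modulo
-- x^K for every K, and is then carried over to the limit coefficient by coefficient. The density
-- follows because the triangular numbers are sparse: about √(2X) of them lie below X, so the n with
-- an odd coefficient have density 0.

Series₂ : Set
Series₂ = ℕ → Bool

infix 4 _≈_
record _≈_ (f g : Series₂) : Set where
  constructor pointwise
  field at : ∀ n → f n ≡ g n
open _≈_

tail : Series₂ → Series₂
tail f n = f (suc n)

-- Opaque, since unification could not recover f and g from λ n → f n xor g n.
infixl 6 _⊕_
opaque
  _⊕_ : Series₂ → Series₂ → Series₂
  (f ⊕ g) n = f n xor g n

  ⊕-coeff : ∀ f g n → (f ⊕ g) n ≡ f n xor g n
  ⊕-coeff f g n = refl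

-- The tail of `f · g` is `scale (f 0) (tail g) ⊕ tail f · g`; the inductions for `·-assoc` and
-- `expand₃-·-coeff` rest on this.
scale : Bool → Series₂ → Series₂
scale c f n = c ∧ f n

infixl 7 _·_
-- The Cauchy product, read off from f = f(0) + x · `tail f`, so that its laws follow by structural
-- induction without index sums.
_·_ : Series₂ → Series₂ → Series₂
(f · g) zero    = f 0 ∧ g 0
(f · g) (suc n) = (f 0 ∧ g (suc n)) xor (tail f · g) n

𝟘 : Series₂
𝟘 _ = false

X^ : ℕ → Series₂
X^ zero    zero    = true
X^ zero    (suc _) = false
X^ (suc _) zero    = false
X^ (suc d) (suc n) = X^ d n

𝟙 : Series₂
𝟙 = X^ 0

·-local : ∀ {f f′ g g′} n → (∀ i → i ≤ n → f i ≡ f′ i) → (∀ i → i ≤ n → g i ≡ g′ i) → (f · g) n ≡ (f′ · g′) n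
·-local zero    p q = cong₂ _∧_ (p 0 z≤n) (q 0 z≤n)
·-local (suc n) p q = cong₂ _xor_
  (cong₂ _∧_ (p 0 z≤n) (q (suc n) (s≤s ≤-refl)))
  (·-local n (λ i i≤n → p (suc i) (s≤s i≤n)) (λ i i≤n → q i (m≤n⇒m≤1+n i≤n)))

≈-refl : ∀ {f} → f ≈ f
≈-refl = pointwise λ _ → refl

≈-sym : ∀ {f g} → f ≈ g → g ≈ f
≈-sym p = pointwise λ n → sym (at p n)

≈-trans : ∀ {f g h} → f ≈ g → g ≈ h → f ≈ h
≈-trans p q = pointwise λ n → trans (at p n) (at q n)

⊕-cong : ∀ {f f′ g g′} → f ≈ f′ → g ≈ g′ → f ⊕ g ≈ f′ ⊕ g′
⊕-cong {f} {f′} {g} {g′} p q = pointwise λ n →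
  trans (⊕-coeff f g n) (trans (cong₂ _xor_ (at p n) (at q n)) (sym (⊕-coeff f′ g′ n)))

·-cong : ∀ {f f′ g g′} → f ≈ f′ → g ≈ g′ → f · g ≈ f′ · g′
·-cong p q = pointwise λ n → ·-local n (λ i _ → at p i) (λ i _ → at q i)

module _ where
  open BoolSolver.xor-∧-Solver

  distrib-step : ∀ a b c s t → ((a xor b) ∧ c) xor (s xor t) ≡ ((a ∧ c) xor s) xor ((b ∧ c) xor t)
  distrib-step = solve 5 (λ a b c s t → (a :+ b) :* c :+ (s :+ t) := (a :* c :+ s) :+ (b :* c :+ t)) refl

  scale-step : ∀ c a b s → ((c ∧ a) ∧ b) xor (c ∧ s) ≡ c ∧ ((a ∧ b) xor s)
  scale-step = solve 4 (λ c a b s → (c :* a) :* b :+ c :* s := c :* (a :* b :+ s)) refl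

  assoc-step : ∀ a b c s t → ((a ∧ b) ∧ c) xor ((a ∧ s) xor t) ≡ (a ∧ ((b ∧ c) xor s)) xor t
  assoc-step = solve 5 (λ a b c s t → (a :* b) :* c :+ (a :* s :+ t) := a :* (b :* c :+ s) :+ t) refl

·-scaleˡ : ∀ c f g n → (scale c f · g) n ≡ c ∧ (f · g) n
·-scaleˡ c f g zero    = ∧-assoc c (f 0) (g 0)
·-scaleˡ c f g (suc n) = trans
  (cong (((c ∧ f 0) ∧ g (suc n)) xor_) (·-scaleˡ c (tail f) g n))
  (scale-step c (f 0) (g (suc n)) _)

opaque
  unfolding _⊕_

  ·-distribʳ : ∀ f g h n → ((f ⊕ g) · h) n ≡ ((f · h) ⊕ (g · h)) n
  ·-distribʳ f g h zero    = ∧-distribʳ-xor (h 0) (f 0) (g 0)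
  ·-distribʳ f g h (suc n) = trans
    (cong (((f 0 xor g 0) ∧ h (suc n)) xor_) (·-distribʳ (tail f) (tail g) h n))
    (distrib-step (f 0) (g 0) (h (suc n)) _ _)

  ·-assoc : ∀ f g h n → ((f · g) · h) n ≡ (f · (g · h)) n
  ·-assoc f g h zero    = ∧-assoc (f 0) (g 0) (h 0)
  ·-assoc f g h (suc n) = begin
    ((f 0 ∧ g 0) ∧ h (suc n)) xor ((scale (f 0) (tail g) ⊕ tail f · g) · h) n
      ≡⟨ cong (((f 0 ∧ g 0) ∧ h (suc n)) xor_) (·-distribʳ (scale (f 0) (tail g)) (tail f · g) h n) ⟩
    ((f 0 ∧ g 0) ∧ h (suc n)) xor ((scale (f 0) (tail g) · h) n xor (tail f · g · h) n)
      ≡⟨ cong (((f 0 ∧ g 0) ∧ h (suc n)) xor_) (cong₂ _xor_ (·-scaleˡ (f 0) (tail g) h n)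
          (·-assoc (tail f) g h n)) ⟩
    ((f 0 ∧ g 0) ∧ h (suc n)) xor ((f 0 ∧ (tail g · h) n) xor (tail f · (g · h)) n)
      ≡⟨ assoc-step (f 0) (g 0) (h (suc n)) _ _ ⟩
    (f · (g · h)) (suc n) ∎
    where open ≡-Reasoning

  ⊕-assoc : ∀ f g h → f ⊕ g ⊕ h ≈ f ⊕ (g ⊕ h)
  ⊕-assoc f g h = pointwise λ n → xor-assoc (f n) (g n) (h n)

  ⊕-comm : ∀ f g → f ⊕ g ≈ g ⊕ f
  ⊕-comm f g = pointwise λ n → xor-comm (f n) (g n)

  ⊕-identityˡ : ∀ f → 𝟘 ⊕ f ≈ f
  ⊕-identityˡ f = ≈-refl

  ⊕-self : ∀ f → f ⊕ f ≈ 𝟘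
  ⊕-self f = pointwise λ n → xor-same (f n)

-- The mirror image of the defining recursion, splitting the second factor; commutativity and the
-- computation of squares both need it.
·-suc : ∀ f g n → (f · g) (suc n) ≡ (f · tail g) n xor (f (suc n) ∧ g 0)
·-suc f g zero    = refl
·-suc f g (suc n) = trans
  (cong ((f 0 ∧ g (suc (suc n))) xor_) (·-suc (tail f) g n))
  (sym (xor-assoc (f 0 ∧ g (suc (suc n))) _ _))

·-comm : ∀ f g n → (f · g) n ≡ (g · f) n
·-comm f g zero    = ∧-comm (f 0) (g 0)
·-comm f g (suc n) = begin
  (f 0 ∧ g (suc n)) xor (tail f · g) n   ≡⟨ cong₂ _xor_ (∧-comm (f 0) (g (suc n))) (·-comm (tail f) g n) ⟩
  (g (suc n) ∧ f 0) xor (g · tail f) n   ≡⟨ xor-comm (g (suc n) ∧ f 0) _ ⟩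
  (g · tail f) n xor (g (suc n) ∧ f 0)   ≡⟨ sym (·-suc g f n) ⟩
  (g · f) (suc n)                        ∎
  where open ≡-Reasoning

·-zeroˡ : ∀ f n → (𝟘 · f) n ≡ false
·-zeroˡ f zero    = refl
·-zeroˡ f (suc n) = ·-zeroˡ f n

·-identityˡ : ∀ f n → (𝟙 · f) n ≡ f n
·-identityˡ f zero    = refl
·-identityˡ f (suc n) = trans (cong (f (suc n) xor_) (·-zeroˡ f n)) (xor-identityʳ (f (suc n)))

-- The commutative ring of series and its solver

Series₂-commutativeRing : CommutativeRing 0ℓ 0ℓ
Series₂-commutativeRing = record
  { Carrier = Series₂ ; _≈_ = _≈_ ; _+_ = _⊕_ ; _*_ = _·_ ; -_ = λ f → f ; 0# = 𝟘 ; 1# = 𝟙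
  ; isCommutativeRing = record
    { isRing = record
      { +-isAbelianGroup = record
        { isGroup = record
          { isMonoid = record
            { isSemigroup = record
              { isMagma = record
                { isEquivalence = record { refl = ≈-refl ; sym = ≈-sym ; trans = ≈-trans }
                ; ∙-cong = ⊕-cong }
              ; assoc = ⊕-assoc }
            ; identity = ⊕-identityˡ , (λ f → ≈-trans (⊕-comm f 𝟘) (⊕-identityˡ f)) }
          ; inverse = ⊕-self , ⊕-self
          ; ⁻¹-cong = λ p → p }
        ; comm = ⊕-comm }
      ; *-cong = ·-cong
      ; *-assoc = λ f g h → pointwise (·-assoc f g h)
      ; *-identity = (λ f → pointwise (·-identityˡ f))
                   , (λ f → pointwise λ n → trans (·-comm f 𝟙 n) (·-identityˡ f n))
      ; distrib = (λ f g h → ≈-trans (pointwise (·-comm f (g ⊕ h))) (≈-trans (pointwise (·-distribʳ g h f))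
                      (⊕-cong (pointwise (·-comm g f)) (pointwise (·-comm h f)))))
                , (λ f g h → pointwise (·-distribʳ g h f)) }
    ; *-comm = λ f g → pointwise (·-comm f g) } }

constant : Bool → Series₂
constant true  = 𝟙
constant false = 𝟘

-- Coefficients in Bool, so that the solver knows that 1 + 1 = 0.
constant-morphism : CommutativeRing.rawRing xor-∧-commutativeRing
                      -Raw-AlmostCommutative⟶ fromCommutativeRing Series₂-commutativeRing
constant-morphism = record
  { ⟦_⟧    = constant
  ; +-homo = λ { false y → ≈-sym (⊕-identityˡ (constant y))
               ; true false → ≈-sym (≈-trans (⊕-comm 𝟙 𝟘) (⊕-identityˡ 𝟙))
               ; true true → ≈-sym (⊕-self 𝟙) }
  ; *-homo = λ { false y → pointwise λ n → sym (·-zeroˡ (constant y) n)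
               ; true y → pointwise λ n → sym (·-identityˡ (constant y) n) }
  ; -‿homo = λ _ → ≈-refl
  ; 0-homo = ≈-refl
  ; 1-homo = ≈-refl }

constant≟ : WeaklyDecidable (Induced-equivalence constant-morphism)
constant≟ false false = just ≈-refl
constant≟ true  true  = just ≈-refl
constant≟ _     _     = nothing

module Solver₂ = RingSolver (CommutativeRing.rawRing xor-∧-commutativeRing)
  (fromCommutativeRing Series₂-commutativeRing) constant-morphism constant≟

open CommutativeRing Series₂-commutativeRing using (setoid)
  renaming (*-identityˡ to 𝟙·; *-identityʳ to ·𝟙; zeroʳ to ·𝟘; +-identityʳ to ⊕𝟘)
import Relation.Binary.Reasoning.Setoid setoid as ≈-Reasoning

swap-middle : ∀ a b c d → a · b · (c · d) ≈ a · c · (b · d)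
swap-middle = solve 4 (λ a b c d → a :* b :* (c :* d) := a :* c :* (b :* d)) ≈-refl
  where open Solver₂

cancel-factor : ∀ {a b} c → a · b ≈ 𝟙 → c ≈ a · (b · c)
cancel-factor {a} {b} c ab≈𝟙 = begin
  c              ≈⟨ ≈-sym (𝟙· c) ⟩
  𝟙 · c          ≈⟨ ·-cong (≈-sym ab≈𝟙) ≈-refl ⟩
  a · b · c      ≈⟨ pointwise (·-assoc a b c) ⟩
  a · (b · c)    ∎
  where open ≈-Reasoning

absorb : ∀ {a b} c → a · b ≈ 𝟙 → a · b · c ≈ c
absorb c ab≈𝟙 = ≈-trans (·-cong ab≈𝟙 ≈-refl) (𝟙· c)

-- Congruence modulo x^K

infix 4 _≈_mod_
record _≈_mod_ (f g : Series₂) (K : ℕ) : Set where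
  constructor below
  field coeff : ∀ i → i < K → f i ≡ g i
open _≈_mod_

≈⇒mod : ∀ {f g K} → f ≈ g → f ≈ g mod K
≈⇒mod p = below λ i _ → at p i

mod-refl : ∀ {f K} → f ≈ f mod K
mod-refl = ≈⇒mod ≈-refl

mod-sym : ∀ {f g K} → f ≈ g mod K → g ≈ f mod K
mod-sym p = below λ i i<K → sym (coeff p i i<K)

mod-trans : ∀ {f g h K} → f ≈ g mod K → g ≈ h mod K → f ≈ h mod K
mod-trans p q = below λ i i<K → trans (coeff p i i<K) (coeff q i i<K)

mod-weaken : ∀ {f g K L} → L ≤ K → f ≈ g mod K → f ≈ g mod L
mod-weaken L≤K p = below λ i i<L → coeff p i (<-≤-trans i<L L≤K)

mod-⊕ : ∀ {f f′ g g′ K} → f ≈ f′ mod K → g ≈ g′ mod K → f ⊕ g ≈ f′ ⊕ g′ mod K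
mod-⊕ {f} {f′} {g} {g′} p q = below λ i i<K →
  trans (⊕-coeff f g i) (trans (cong₂ _xor_ (coeff p i i<K) (coeff q i i<K)) (sym (⊕-coeff f′ g′ i)))

mod-· : ∀ {f f′ g g′ K} → f ≈ f′ mod K → g ≈ g′ mod K → f · g ≈ f′ · g′ mod K
mod-· p q = below λ i i<K → ·-local i
  (λ j j≤i → coeff p j (≤-<-trans j≤i i<K)) (λ j j≤i → coeff q j (≤-<-trans j≤i i<K))

mod-⇒≈ : ∀ {f g} → (∀ K → f ≈ g mod K) → f ≈ g
mod-⇒≈ p = pointwise λ n → coeff (p (suc n)) n (n<1+n n)

-- Monomials and geometric series

X^-+ : ∀ d e → X^ (d + e) ≈ X^ d · X^ e
X^-+ d e = pointwise (go d)
  where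
  go : ∀ d n → X^ (d + e) n ≡ (X^ d · X^ e) n
  go zero    n       = sym (·-identityˡ (X^ e) n)
  go (suc d) zero    = refl
  go (suc d) (suc n) = go d n

X^≡ : ∀ {d e} → d ≡ e → X^ d ≈ X^ e
X^≡ refl = ≈-refl

X^·-< : ∀ d f {n} → n < d → (X^ d · f) n ≡ false
X^·-< (suc d) f {zero}  _         = refl
X^·-< (suc d) f {suc n} (s<s n<d) = X^·-< d f n<d

X^·-+ : ∀ d f n → (X^ d · f) (d + n) ≡ f n
X^·-+ zero    f n = ·-identityˡ f n
X^·-+ (suc d) f n = X^·-+ d f n

X^≈𝟘 : ∀ {d K} → K ≤ d → X^ d ≈ 𝟘 mod K
X^≈𝟘 {d} K≤d = below λ i i<K → vanish d (<-≤-trans i<K K≤d)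
  where
  vanish : ∀ d {n} → n < d → X^ d n ≡ false
  vanish (suc d) {zero}  _         = refl
  vanish (suc d) {suc n} (s<s n<d) = vanish d n<d

X^-self : ∀ d → X^ d d ≡ true
X^-self zero    = refl
X^-self (suc d) = X^-self d

X^-true : ∀ d n → X^ d n ≡ true → n ≡ d
X^-true zero    zero    _ = refl
X^-true (suc d) (suc n) p = cong suc (X^-true d n p)

geom : ℕ → Series₂
geom d n = does (d ∣? n)

geom-inverse : ∀ d → (𝟙 ⊕ X^ (suc d)) · geom (suc d) ≈ 𝟙
geom-inverse d = pointwise λ n → trans (expand n) (go n)
  where
  open ≡-Reasoning
  g = geom (suc d)
  expand : ∀ n → ((𝟙 ⊕ X^ (suc d)) · g) n ≡ g n xor (X^ (suc d) · g) n
  expand n = trans (·-distribʳ 𝟙 (X^ (suc d)) g n) (trans (⊕-coeff (𝟙 · g) (X^ (suc d) · g) n)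
    (cong (_xor (X^ (suc d) · g) n) (·-identityˡ g n)))
  small : ∀ n → n < suc d → g n ≡ 𝟙 n
  small zero    _     = refl
  small (suc n) 1+n<d = dec-false (suc d ∣? suc n) (>⇒∤ 1+n<d)
  go : ∀ n → g n xor (X^ (suc d) · g) n ≡ 𝟙 n
  go n with n <? suc d
  ... | yes n<d = trans (cong (g n xor_) (X^·-< (suc d) g n<d)) (trans (xor-identityʳ (g n)) (small n n<d))
  ... | no  n≮d with m≤n⇒∃[o]m+o≡n (≮⇒≥ n≮d)
  ...   | m , refl = begin
    g (suc d + m) xor (X^ (suc d) · g) (suc d + m)
      -- From degree d on, the coefficients at d + m and at m cancel, since d divides both or
      -- neither.
      ≡⟨ cong₂ _xor_ (does-⇔ (mk⇔ (λ p → ∣m+n∣m⇒∣n p ∣-refl) (∣m∣n⇒∣m+n ∣-refl)) (suc d ∣? (suc d + m))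
          (suc d ∣? m)) (X^·-+ (suc d) g m) ⟩
    g m xor g m ≡⟨ xor-same (g m) ⟩
    false ∎

-- Finite and infinite products

-- The product ranges over 1 ≤ i ≤ n.
∏ : ℕ → (ℕ → Series₂) → Series₂
∏ zero    F = 𝟙
∏ (suc n) F = F (suc n) · ∏ n F

-- The n-th coefficient is taken from the n-th partial product, as in the definition of `P`. This is
-- the infinite product when the n-th factor is 1 modulo x^n, the hypothesis of `∏∞-approx`.
∏∞ : (ℕ → Series₂) → Series₂
∏∞ F n = ∏ n F n

∏-stable : ∀ F → (∀ n → F (suc n) ≈ 𝟙 mod suc n) → ∀ k n → ∏ (k + n) F ≈ ∏ n F mod suc n
∏-stable F F≈𝟙 zero    n = mod-refl
∏-stable F F≈𝟙 (suc k) n = mod-trans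
  (mod-· (mod-weaken (s≤s (m≤n+m n k)) (F≈𝟙 (k + n))) (∏-stable F F≈𝟙 k n))
  (≈⇒mod (𝟙· (∏ n F)))

∏∞-approx : ∀ F → (∀ n → F (suc n) ≈ 𝟙 mod suc n) → ∀ n → ∏∞ F ≈ ∏ n F mod suc n
∏∞-approx F F≈𝟙 n = below λ i i<1+n → go i (m≤n⇒∃[o]m+o≡n (s≤s⁻¹ i<1+n))
  where
  go : ∀ i → ∃[ k ] i + k ≡ n → ∏∞ F i ≡ ∏ n F i
  go i (k , refl) = subst (λ m → ∏ i F i ≡ ∏ m F i) (+-comm k i)
    (sym (coeff (∏-stable F F≈𝟙 k i) i (n<1+n i)))

∏-inverse : ∀ F G → (∀ n → F (suc n) · G (suc n) ≈ 𝟙) → ∀ n → ∏ n F · ∏ n G ≈ 𝟙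
∏-inverse F G FG≈𝟙 zero    = 𝟙· 𝟙
∏-inverse F G FG≈𝟙 (suc n) = begin
  F (suc n) · ∏ n F · (G (suc n) · ∏ n G)   ≈⟨ swap-middle (F (suc n)) (∏ n F) (G (suc n)) (∏ n G) ⟩
  F (suc n) · G (suc n) · (∏ n F · ∏ n G)   ≈⟨ ·-cong (FG≈𝟙 n) (∏-inverse F G FG≈𝟙 n) ⟩
  𝟙 · 𝟙                                     ≈⟨ 𝟙· 𝟙 ⟩
  𝟙                                         ∎
  where open ≈-Reasoning

-- Telescoping sums for the products of Euler and Gauss

Σ≤ : ℕ → (ℕ → Series₂) → Series₂
Σ≤ zero    t = t 0
Σ≤ (suc r) t = Σ≤ r t ⊕ t (suc r)

Σ≤-head : ∀ r t {K} → (∀ s → t (suc s) ≈ 𝟘 mod K) → Σ≤ r t ≈ t 0 mod K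
Σ≤-head zero    t small = mod-refl
Σ≤-head (suc r) t small = mod-trans (mod-⊕ (Σ≤-head r t small) (small r))
  (≈⇒mod (⊕𝟘 (t 0)))

-- The common induction step of both telescopes: S′ and S are partial sums for n + 1 and n, u is the
-- correction between them, and after the next terms t′ and t the correction has become u′.
telescope-step : ∀ {S S′ t t′ u u′} → S′ ≈ S ⊕ u → u ⊕ t′ ≈ t ⊕ u′ → S′ ⊕ t′ ≈ (S ⊕ t) ⊕ u′
telescope-step {S} {S′} {t} {t′} {u} {u′} p q = begin
  S′ ⊕ t′        ≈⟨ ⊕-cong p ≈-refl ⟩
  S ⊕ u ⊕ t′     ≈⟨ solve 3 (λ S u t → S :+ u :+ t := S :+ (u :+ t)) ≈-refl S u t′ ⟩
  S ⊕ (u ⊕ t′)   ≈⟨ ⊕-cong ≈-refl q ⟩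
  S ⊕ (t ⊕ u′)   ≈⟨ solve 3 (λ S u t → S :+ (u :+ t) := S :+ u :+ t) ≈-refl S t u′ ⟩
  S ⊕ t ⊕ u′     ∎
  where
  open ≈-Reasoning
  open Solver₂

tri : ℕ → ℕ
tri zero    = 0
tri (suc n) = suc n + tri n

1+X^ : ℕ → Series₂
1+X^ d = 𝟙 ⊕ X^ d

eulerUpTo eulerUpTo⁻¹ : ℕ → Series₂
eulerUpTo   n = ∏ n 1+X^
eulerUpTo⁻¹ n = ∏ n geom

eulerUpTo-inverse : ∀ n → eulerUpTo n · eulerUpTo⁻¹ n ≈ 𝟙
eulerUpTo-inverse = ∏-inverse 1+X^ geom geom-inverse

-- Shanks' proof of the pentagonal number theorem.
eulerTerm : ℕ → ℕ → Series₂
eulerTerm n s = eulerUpTo n · eulerUpTo⁻¹ s · X^ (s * n + tri s)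

-- Raising n by 1 changes the partial sum by one product term only. At r = n the two Euler products
-- in it cancel and a bare monomial is left, one of the two new pentagonal terms. The signs of the
-- integral identity disappear modulo 2.
euler-telescope : ∀ n r → Σ≤ r (eulerTerm (suc n)) ≈
  Σ≤ r (eulerTerm n) ⊕ eulerUpTo n · eulerUpTo⁻¹ r · X^ (suc r * suc n + tri r)
euler-telescope n zero = begin
  (𝟙 ⊕ X^ (suc n)) · F · 𝟙 · 𝟙
    ≈⟨ solve 2 (λ z f → (con true :+ z) :* f :* con true :* con true := f :* con true :* con true :+ f :* con
        true :* z) ≈-refl (X^ (suc n)) F ⟩
  F · 𝟙 · 𝟙 ⊕ F · 𝟙 · X^ (suc n)            ≈⟨ ⊕-cong ≈-refl (·-cong ≈-refl (X^≡ (e n))) ⟩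
  F · 𝟙 · 𝟙 ⊕ F · 𝟙 · X^ (1 * suc n + 0)    ∎
  where
  open ≈-Reasoning
  open Solver₂
  F = eulerUpTo n
  e : ∀ n → suc n ≡ 1 * suc n + 0
  e = solve-∀
euler-telescope n (suc r) = telescope-step (euler-telescope n r) (begin
  -- The old correction lacks the factor `geom (suc r)` of the new terms. Writing G as (1 + y) · G′
  -- makes F · G′ · w common to all terms, and what remains is (1 + y) + (1 + z) y = 1 + y z.
  F · G · X^ (suc r * suc n + tri r) ⊕ (𝟙 ⊕ z) · F · G′ · X^ (suc r * suc n + tri (suc r))
    ≈⟨ ⊕-cong (·-cong (·-cong ≈-refl (cancel-factor G (geom-inverse r))) (X^≡ (e₁ r n (tri r))))
        (·-cong ≈-refl (≈-trans (X^≡ (e₂ r n (tri (suc r)))) (X^-+ (suc r * n + tri (suc r)) (suc r)))) ⟩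
  F · ((𝟙 ⊕ y) · G′) · w ⊕ (𝟙 ⊕ z) · F · G′ · (w · y)
    ≈⟨ solve 5 (λ f g w y z → f :* ((con true :+ y) :* g) :* w :+ (con true :+ z) :* f :* g :* (w :* y)
                           := f :* g :* w :+ f :* g :* (w :* (y :* z))) ≈-refl F G′ w y z ⟩
  F · G′ · w ⊕ F · G′ · (w · (y · z))
    ≈⟨ ⊕-cong ≈-refl (·-cong ≈-refl (≈-trans (·-cong ≈-refl (≈-sym (X^-+ (suc r) (suc n))))
        (≈-trans (≈-sym (X^-+ (suc r * n + tri (suc r)) _)) (X^≡ (e₃ r n (tri (suc r))))))) ⟩
  F · G′ · w ⊕ F · G′ · X^ (suc (suc r) * suc n + tri (suc r)) ∎)
  where
  open ≈-Reasoning
  open Solver₂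
  F = eulerUpTo n
  G = eulerUpTo⁻¹ r
  G′ = eulerUpTo⁻¹ (suc r)
  w = X^ (suc r * n + tri (suc r))
  y = X^ (suc r)
  z = X^ (suc n)
  e₁ : ∀ r n t → suc r * suc n + t ≡ suc r * n + (suc r + t)
  e₁ = solve-∀
  e₂ : ∀ r n t → suc r * suc n + t ≡ (suc r * n + t) + suc r
  e₂ = solve-∀
  e₃ : ∀ r n t → (suc r * n + t) + (suc r + suc n) ≡ suc (suc r) * suc n + t
  e₃ = solve-∀

gaussFactor gaussFactor⁻¹ : ℕ → Series₂
gaussFactor zero      = 𝟙
gaussFactor (suc s)   = 1+X^ (2 * suc s) · geom (suc (2 * s))
gaussFactor⁻¹ zero    = 𝟙
gaussFactor⁻¹ (suc s) = geom (2 * suc s) · 1+X^ (suc (2 * s))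

gaussUpTo gaussUpTo⁻¹ : ℕ → Series₂
gaussUpTo   n = ∏ n gaussFactor
gaussUpTo⁻¹ n = ∏ n gaussFactor⁻¹

gaussUpTo-inverse : ∀ n → gaussUpTo n · gaussUpTo⁻¹ n ≈ 𝟙
gaussUpTo-inverse = ∏-inverse gaussFactor gaussFactor⁻¹ λ s → begin
  1+X^ (2 * suc s) · geom (suc (2 * s)) · (geom (2 * suc s) · 1+X^ (suc (2 * s)))
    ≈⟨ solve 4 (λ a b c d → a :* b :* (c :* d) := a :* c :* (d :* b)) ≈-refl
         (1+X^ (2 * suc s)) (geom (suc (2 * s))) (geom (2 * suc s)) (1+X^ (suc (2 * s))) ⟩
  1+X^ (2 * suc s) · geom (2 * suc s) · (1+X^ (suc (2 * s)) · geom (suc (2 * s)))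
    ≈⟨ ·-cong (geom-inverse (s + suc (s + 0))) (geom-inverse (2 * s)) ⟩
  𝟙 · 𝟙 ≈⟨ 𝟙· 𝟙 ⟩
  𝟙 ∎
  where
  open ≈-Reasoning
  open Solver₂

-- Shanks' proof of Gauss' identity Σ xⁿ⁽ⁿ⁺¹⁾⸍² = ∏ (1 - x²ⁿ) / (1 - x²ⁿ⁻¹).
gaussTerm : ℕ → ℕ → Series₂
gaussTerm n s = gaussUpTo n · gaussUpTo⁻¹ s · X^ (s * suc (2 * n))

-- Here the correction carries the extra quotient (1 + x^(2r+1)) / (1 + x^(2n+1)), which becomes 1
-- at r = n. The monomial left is then x^((n+1)(2n+1)), whose exponent is `tri (suc (2 * n))`.
gauss-telescope : ∀ n r → Σ≤ r (gaussTerm (suc n)) ≈ Σ≤ r (gaussTerm n)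
  ⊕ gaussUpTo n · gaussUpTo⁻¹ r · X^ (suc r * suc (2 * n)) · (1+X^ (suc (2 * r)) · geom (suc (2 * n)))
gauss-telescope n zero = begin
  1+X^ (2 * suc n) · g · R · 𝟙 · 𝟙
    ≈⟨ ·-cong (·-cong (·-cong (·-cong (⊕-cong ≈-refl (≈-trans (X^≡ (e₁ n)) (X^-+ (suc (2 * n)) 1))) ≈-refl)
        ≈-refl) ≈-refl) ≈-refl ⟩
  (𝟙 ⊕ w · x) · g · R · 𝟙 · 𝟙
    ≈⟨ solve 4 (λ w x g R → (con true :+ w :* x) :* g :* R :* con true :* con true
                 := (con true :+ w) :* (g :* R) :* con true :* con true :+ R :* con true :* w :*
                     ((con true :+ x) :* g)) ≈-refl w x g R ⟩
  1+X^ (suc (2 * n)) · (g · R) · 𝟙 · 𝟙 ⊕ R · 𝟙 · w · (1+X^ 1 · g)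
    ≈⟨ ⊕-cong (·-cong (·-cong (≈-sym (cancel-factor R (geom-inverse (2 * n)))) ≈-refl) ≈-refl)
        (·-cong (·-cong ≈-refl (X^≡ (e₂ n))) ≈-refl) ⟩
  R · 𝟙 · 𝟙 ⊕ R · 𝟙 · X^ (1 * suc (2 * n)) · (1+X^ 1 · g) ∎
  where
  open ≈-Reasoning
  open Solver₂
  R = gaussUpTo n
  g = geom (suc (2 * n))
  w = X^ (suc (2 * n))
  x = X^ 1
  e₁ : ∀ n → 2 * suc n ≡ suc (2 * n) + 1
  e₁ = solve-∀
  e₂ : ∀ n → suc (2 * n) ≡ 1 * suc (2 * n)
  e₂ = solve-∀
gauss-telescope n (suc r) = telescope-step (gauss-telescope n r) (begin
  -- All monomials are expressed through w = x^(2n+1), y = x^(2r+1) and x. Up to the common factor R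
  -- k Q W g (1 + y), both sides of the identity are 1 + w y x².
  R · Q · W · ((𝟙 ⊕ y) · g) ⊕ 1+X^ (2 * suc n) · g · R · Q′ · X^ (suc r * suc (2 * suc n))
    ≈⟨ ⊕-cong (·-cong (·-cong (·-cong ≈-refl (cancel-factor Q
        (≈-trans (·-cong (⊕-cong ≈-refl (≈-sym yx)) ≈-refl) (geom-inverse (r + suc (r + 0)))))) ≈-refl) ≈-refl)
              (·-cong (·-cong (·-cong (·-cong (⊕-cong ≈-refl wx) ≈-refl) ≈-refl) ≈-refl)
                  (≈-trans (X^≡ (e₃ r n)) (≈-trans (X^-+ (suc r * suc (2 * n)) _) (·-cong ≈-refl yx)))) ⟩
  R · ((𝟙 ⊕ y · x) · (k · Q)) · W · ((𝟙 ⊕ y) · g) ⊕ (𝟙 ⊕ w · x) · g · R · (k · (𝟙 ⊕ y) · Q) · (W · (y · x))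
    ≈⟨ solve 8 (λ R Q W w x y k g →
          R :* ((con true :+ y :* x) :* (k :* Q)) :* W :* ((con true :+ y) :* g)
            :+ (con true :+ w :* x) :* g :* R :* (k :* (con true :+ y) :* Q) :* (W :* (y :* x))
          := (con true :+ w) :* (g :* R) :* (k :* (con true :+ y) :* Q) :* W
            :+ R :* (k :* (con true :+ y) :* Q) :* (w :* W) :* ((con true :+ y :* (x :* x)) :* g)) ≈-refl R Q W
                w x y k g ⟩
  (𝟙 ⊕ w) · (g · R) · Q′ · W ⊕ R · Q′ · (w · W) · ((𝟙 ⊕ y · (x · x)) · g)
    ≈⟨ ⊕-cong (·-cong (·-cong (≈-sym (cancel-factor R (geom-inverse (2 * n)))) ≈-refl) ≈-refl)
              (·-cong (·-cong ≈-refl (≈-sym (X^-+ (suc (2 * n)) (suc r * suc (2 * n)))))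
                  (·-cong (⊕-cong ≈-refl yxx) ≈-refl)) ⟩
  R · Q′ · W ⊕ R · Q′ · X^ (suc (suc r) * suc (2 * n)) · (1+X^ (suc (2 * suc r)) · g) ∎)
  where
  open ≈-Reasoning
  open Solver₂
  R = gaussUpTo n
  Q = gaussUpTo⁻¹ r
  Q′ = gaussUpTo⁻¹ (suc r)
  W = X^ (suc r * suc (2 * n))
  w = X^ (suc (2 * n))
  y = X^ (suc (2 * r))
  x = X^ 1
  k = geom (2 * suc r)
  g = geom (suc (2 * n))
  e₁ : ∀ n → 2 * suc n ≡ suc (2 * n) + 1
  e₁ = solve-∀
  e₂ : ∀ r → suc (2 * r) + 2 ≡ suc (2 * suc r)
  e₂ = solve-∀
  e₃ : ∀ r n → suc r * suc (2 * suc n) ≡ suc r * suc (2 * n) + 2 * suc r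
  e₃ = solve-∀
  wx : X^ (2 * suc n) ≈ w · x
  wx = ≈-trans (X^≡ (e₁ n)) (X^-+ (suc (2 * n)) 1)
  yx : X^ (2 * suc r) ≈ y · x
  yx = ≈-trans (X^≡ (e₁ r)) (X^-+ (suc (2 * r)) 1)
  yxx : y · (x · x) ≈ X^ (suc (2 * suc r))
  yxx = ≈-trans (·-cong ≈-refl (≈-sym (X^-+ 1 1))) (≈-trans (≈-sym (X^-+ (suc (2 * r)) 2)) (X^≡ (e₂ r)))

-- Pentagonal and triangular sums as truncated products

-- With k = n + 1 the exponents are k(3k - 1)/2 and k(3k + 1)/2, written the way the telescope
-- produces them and the way `tri-3n+2` and `tri-3n+3` express them.
pentagonalSum : ℕ → Series₂
pentagonalSum zero    = 𝟙
pentagonalSum (suc n) = pentagonalSum n ⊕ X^ (suc n * suc n + tri n) ⊕ X^ (suc n * suc n + tri (suc n))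

triangularSum : ℕ → Series₂
triangularSum n = Σ≤ n (λ j → X^ (tri j))

Σ≤-eulerTerm : ∀ n → Σ≤ n (eulerTerm n) ≈ pentagonalSum n
Σ≤-eulerTerm zero    = ≈-trans (·-cong (𝟙· 𝟙) ≈-refl) (𝟙· 𝟙)
Σ≤-eulerTerm (suc n) = ⊕-cong
  (≈-trans (euler-telescope n n) (⊕-cong (Σ≤-eulerTerm n) (absorb _ (eulerUpTo-inverse n))))
  (absorb _ (eulerUpTo-inverse (suc n)))

tri-odd : ∀ n → tri (suc (2 * n)) ≡ suc n * suc (2 * n)
tri-odd zero    = refl
tri-odd (suc n) = begin
  tri (suc (2 * suc n))                                 ≡⟨ cong (λ m → tri (suc m)) (*-suc 2 n) ⟩
  suc (suc (suc (2 * n))) + (suc (suc (2 * n)) + tri (suc (2 * n)))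
    ≡⟨ cong (λ t → suc (suc (suc (2 * n))) + (suc (suc (2 * n)) + t)) (tri-odd n) ⟩
  suc (suc (suc (2 * n))) + (suc (suc (2 * n)) + suc n * suc (2 * n)) ≡⟨ e n ⟩
  suc (suc n) * suc (2 * suc n) ∎
  where
  open ≡-Reasoning
  e : ∀ n → suc (suc (suc (2 * n))) + (suc (suc (2 * n)) + suc n * suc (2 * n)) ≡ suc (suc n) * suc (2 * suc n)
  e = solve-∀

-- Each step contributes two triangular monomials: the correction gives index 2n + 1, and the new
-- last term gives index 2n + 2.
Σ≤-gaussTerm : ∀ n → Σ≤ n (gaussTerm n) ≈ triangularSum (2 * n)
Σ≤-gaussTerm zero    = ≈-trans (·-cong (𝟙· 𝟙) ≈-refl) (𝟙· 𝟙)
Σ≤-gaussTerm (suc n) = begin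
  Σ≤ n (gaussTerm (suc n)) ⊕ gaussTerm (suc n) (suc n)
    ≈⟨ ⊕-cong (gauss-telescope n n) (absorb _ (gaussUpTo-inverse (suc n))) ⟩
  Σ≤ n (gaussTerm n) ⊕ R · R⁻¹ · W · (p · g) ⊕ X^ (suc n * suc (2 * suc n))
    ≈⟨ ⊕-cong (⊕-cong (Σ≤-gaussTerm n) (≈-trans (·-cong (absorb W (gaussUpTo-inverse n)) (geom-inverse (2 * n)))
        (·𝟙 W))) (X^≡ (e n)) ⟩
  triangularSum (2 * n) ⊕ W ⊕ X^ (suc (suc (2 * n)) + suc n * suc (2 * n))
    ≈⟨ ⊕-cong (⊕-cong ≈-refl (X^≡ (sym (tri-odd n)))) (X^≡ (cong (suc (suc (2 * n)) +_) (sym (tri-odd n)))) ⟩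
  triangularSum (suc (suc (2 * n)))
    ≡⟨ cong triangularSum (sym (*-suc 2 n)) ⟩
  triangularSum (2 * suc n) ∎
  where
  open ≈-Reasoning
  R = gaussUpTo n
  R⁻¹ = gaussUpTo⁻¹ n
  W = X^ (suc n * suc (2 * n))
  p = 1+X^ (suc (2 * n))
  g = geom (suc (2 * n))
  e : ∀ n → suc n * suc (2 * suc n) ≡ suc (suc (2 * n)) + suc n * suc (2 * n)
  e = solve-∀

vanishing-term : ∀ {d K} f → K ≤ d → f · X^ d ≈ 𝟘 mod K
vanishing-term f K≤d = mod-trans (mod-· mod-refl (X^≈𝟘 K≤d)) (≈⇒mod (·𝟘 f))

two-ones : ∀ f → f · 𝟙 · 𝟙 ≈ f
two-ones = solve 1 (λ f → f :* con true :* con true := f) ≈-refl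
  where open Solver₂

-- Every term with s ≥ 1 has a monomial of degree at least n, so modulo x^n only the term s = 0
-- survives, and that is the Euler product itself.
eulerUpTo-pentagonal : ∀ n → eulerUpTo n ≈ pentagonalSum n mod n
eulerUpTo-pentagonal n = mod-sym (mod-trans (≈⇒mod (≈-sym (Σ≤-eulerTerm n)))
  (mod-trans (Σ≤-head n (eulerTerm n) (λ s → vanishing-term _
      (≤-trans (m≤m+n n (s * n)) (m≤m+n (suc s * n) (tri (suc s))))))
             (≈⇒mod (two-ones (eulerUpTo n)))))

gaussUpTo-triangular : ∀ n → gaussUpTo n ≈ triangularSum (2 * n) mod n
gaussUpTo-triangular n = mod-sym (mod-trans (≈⇒mod (≈-sym (Σ≤-gaussTerm n)))
  (mod-trans (Σ≤-head n (gaussTerm n) (λ s → vanishing-term _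
      (≤-trans (≤-trans (m≤n*m n 2) (n≤1+n (2 * n))) (m≤m+n (suc (2 * n)) (s * suc (2 * n))))))
             (≈⇒mod (two-ones (gaussUpTo n)))))

1+X^-double : ∀ d → 1+X^ (2 * d) ≈ 1+X^ d · 1+X^ d
1+X^-double d = ≈-trans
  (⊕-cong ≈-refl (≈-trans (X^≡ (cong (d +_) (+-identityʳ d))) (X^-+ d d)))
  (solve 1 (λ x → con true :+ x :* x := (con true :+ x) :* (con true :+ x)) ≈-refl (X^ d))
  where open Solver₂

-- The factors of `eulerUpTo (2 * n)` with odd exponent cancel the denominators, and those with even
-- exponent square the numerator ∏ (1 + x^(2s)). In characteristic 2 that square is the fourth power
-- of `eulerUpTo n`. In the limit both Euler products are f, so the Gauss product is f³.
gaussUpTo-euler : ∀ n → gaussUpTo n · eulerUpTo (2 * n) ≈ eulerUpTo n · eulerUpTo n · eulerUpTo n · eulerUpTo n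
gaussUpTo-euler zero    = solve 0 (con true :* con true := con true :* con true :* con true :* con true) ≈-refl
  where open Solver₂
gaussUpTo-euler (suc n) = begin
  1+X^ (2 * suc n) · g · R · eulerUpTo (2 * suc n)
    ≡⟨ cong (λ m → 1+X^ (2 * suc n) · g · R · eulerUpTo m) (*-suc 2 n) ⟩
  1+X^ (2 * suc n) · g · R · (1+X^ (suc (suc (2 * n))) · (p · E₂))
    ≈⟨ ·-cong ≈-refl (·-cong (⊕-cong ≈-refl (X^≡ (sym (*-suc 2 n)))) ≈-refl) ⟩
  1+X^ (2 * suc n) · g · R · (1+X^ (2 * suc n) · (p · E₂))
    ≈⟨ solve 5 (λ q g R p E → q :* g :* R :* (q :* (p :* E)) := p :* g :* (q :* q :* (R :* E))) ≈-refl
        (1+X^ (2 * suc n)) g R p E₂ ⟩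
  p · g · (1+X^ (2 * suc n) · 1+X^ (2 * suc n) · (R · E₂))
    ≈⟨ absorb _ (geom-inverse (2 * n)) ⟩
  1+X^ (2 * suc n) · 1+X^ (2 * suc n) · (R · E₂)
    ≈⟨ ·-cong (·-cong (1+X^-double (suc n)) (1+X^-double (suc n))) (gaussUpTo-euler n) ⟩
  u · u · (u · u) · (E · E · E · E)
    ≈⟨ solve 2 (λ u E → u :* u :* (u :* u) :* (E :* E :* E :* E) := u :* E :* (u :* E) :* (u :* E) :* (u :* E))
        ≈-refl u E ⟩
  u · E · (u · E) · (u · E) · (u · E) ∎
  where
  open ≈-Reasoning
  open Solver₂
  R = gaussUpTo n
  g = geom (suc (2 * n))
  p = 1+X^ (suc (2 * n))
  u = 1+X^ (suc n)
  E = eulerUpTo n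
  E₂ = eulerUpTo (2 * n)

1+X^≈𝟙 : ∀ n → 1+X^ (suc n) ≈ 𝟙 mod suc n
1+X^≈𝟙 n = mod-trans (mod-⊕ mod-refl (X^≈𝟘 ≤-refl)) (≈⇒mod (⊕𝟘 𝟙))

-- The series f and its cube

euler : Series₂
euler = ∏∞ 1+X^

euler≈eulerUpTo : ∀ n → euler ≈ eulerUpTo n mod suc n
euler≈eulerUpTo = ∏∞-approx 1+X^ 1+X^≈𝟙

cube : Series₂ → Series₂
cube f = f · f · f

mod-cube : ∀ {f g K} → f ≈ g mod K → cube f ≈ cube g mod K
mod-cube p = mod-· (mod-· p p) p

tri-≥ : ∀ n → n ≤ tri n
tri-≥ zero    = z≤n
tri-≥ (suc n) = m≤m+n (suc n) (tri n)

tri-mono : ∀ k n → tri n ≤ tri (k + n)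
tri-mono zero    n = ≤-refl
tri-mono (suc k) n = ≤-trans (tri-mono k n) (m≤n+m (tri (k + n)) (suc (k + n)))

triangularSum-stable : ∀ k n → triangularSum (k + n) ≈ triangularSum n mod tri (suc n)
triangularSum-stable zero    n = mod-refl
triangularSum-stable (suc k) n = mod-trans
  (mod-⊕ (triangularSum-stable k n) (X^≈𝟘 (subst (λ m → tri (suc n) ≤ tri m) (+-suc k n) (tri-mono k (suc n)))))
  (≈⇒mod (⊕𝟘 _))

euler-pentagonal : ∀ n → euler ≈ pentagonalSum n mod n
euler-pentagonal n = mod-trans (mod-weaken (n≤1+n n) (euler≈eulerUpTo n)) (eulerUpTo-pentagonal n)

cube-euler-triangular : ∀ n → cube euler ≈ triangularSum n mod n
cube-euler-triangular n =
  mod-trans (mod-cube (mod-weaken (n≤1+n n) (euler≈eulerUpTo n)))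
  -- The product E₂ · E₂⁻¹ is inserted and E₂ is replaced by E, which agrees with it modulo x^n.
  -- This produces E⁴ · E₂⁻¹, which is the Gauss product.
  (mod-trans (≈⇒mod (cancel-factor (cube E) (eulerUpTo-inverse (2 * n))))
  (mod-trans (mod-· E₂≈E mod-refl)
  (mod-trans (≈⇒mod regroup)
  (mod-trans (gaussUpTo-triangular n)
             (mod-weaken (≤-trans (n≤1+n n) (tri-≥ (suc n)))
                 (subst (λ m → triangularSum (n + m) ≈ triangularSum n mod tri (suc n)) (sym (+-identityʳ n))
                     (triangularSum-stable n n)))))))
  where
  open Solver₂
  E  = eulerUpTo n
  E₂ = eulerUpTo (2 * n)
  E₂⁻¹ = eulerUpTo⁻¹ (2 * n)
  R  = gaussUpTo n
  E₂≈E : E₂ ≈ E mod n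
  E₂≈E = mod-trans (mod-sym (mod-weaken (≤-trans (m≤n*m n 2) (n≤1+n (2 * n))) (euler≈eulerUpTo (2 * n))))
                   (mod-weaken (n≤1+n n) (euler≈eulerUpTo n))
  regroup : E · (E₂⁻¹ · cube E) ≈ R
  regroup = begin
    E · (E₂⁻¹ · cube E)
      ≈⟨ solve 2 (λ e i → e :* (i :* (e :* e :* e)) := e :* e :* e :* e :* i) ≈-refl E E₂⁻¹ ⟩
    E · E · E · E · E₂⁻¹   ≈⟨ ·-cong (≈-sym (gaussUpTo-euler n)) ≈-refl ⟩
    R · E₂ · E₂⁻¹          ≈⟨ solve 3 (λ r e i → r :* e :* i := e :* i :* r) ≈-refl R E₂ E₂⁻¹ ⟩
    E₂ · E₂⁻¹ · R          ≈⟨ absorb R (eulerUpTo-inverse (2 * n)) ⟩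
    R                      ∎
    where open ≈-Reasoning

-- Series in x³

-- f(x) ↦ f(x³)
expand₃ : Series₂ → Series₂
expand₃ f 0                   = f 0
expand₃ f 1                   = false
expand₃ f 2                   = false
expand₃ f (suc (suc (suc n))) = expand₃ (tail f) n

expand₃-local : ∀ {f g} n → (∀ i → i ≤ n → f i ≡ g i) → expand₃ f n ≡ expand₃ g n
expand₃-local 0                   p = p 0 z≤n
expand₃-local 1                   p = refl
expand₃-local 2                   p = refl
expand₃-local (suc (suc (suc n))) p = expand₃-local n λ i i≤n → p (suc i) (s≤s (m≤n⇒m≤1+n (m≤n⇒m≤1+n i≤n)))

expand₃-cong : ∀ {f g} → f ≈ g → expand₃ f ≈ expand₃ g
expand₃-cong p = pointwise λ n → expand₃-local n λ i _ → at p i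

mod-expand₃ : ∀ {f g K} → f ≈ g mod K → expand₃ f ≈ expand₃ g mod K
mod-expand₃ p = below λ n n<K → expand₃-local n λ i i≤n → coeff p i (≤-<-trans i≤n n<K)

expand₃-𝟘 : expand₃ 𝟘 ≈ 𝟘
expand₃-𝟘 = pointwise go
  where
  go : ∀ n → expand₃ 𝟘 n ≡ false
  go 0                   = refl
  go 1                   = refl
  go 2                   = refl
  go (suc (suc (suc n))) = go n

expand₃-X^ : ∀ d → expand₃ (X^ d) ≈ X^ (3 * d)
expand₃-X^ zero    = pointwise λ where
    0                   → refl
    1                   → refl
    2                   → refl
    (suc (suc (suc n))) → at expand₃-𝟘 n
expand₃-X^ (suc d) = ≈-trans (pointwise shift) (X^≡ (sym (*-suc 3 d)))
  where
  shift : ∀ n → expand₃ (X^ (suc d)) n ≡ X^ (3 + 3 * d) n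
  shift 0                   = refl
  shift 1                   = refl
  shift 2                   = refl
  shift (suc (suc (suc n))) = at (expand₃-X^ d) n

expand₃-scale : ∀ c f n → expand₃ (scale c f) n ≡ c ∧ expand₃ f n
expand₃-scale c f 0                   = refl
expand₃-scale c f 1                   = sym (∧-zeroʳ c)
expand₃-scale c f 2                   = sym (∧-zeroʳ c)
expand₃-scale c f (suc (suc (suc n))) = expand₃-scale c (tail f) n

opaque
  unfolding _⊕_

  expand₃-⊕-coeff : ∀ f g n → expand₃ (f ⊕ g) n ≡ expand₃ f n xor expand₃ g n
  expand₃-⊕-coeff f g 0                   = refl
  expand₃-⊕-coeff f g 1                   = refl
  expand₃-⊕-coeff f g 2                   = refl
  expand₃-⊕-coeff f g (suc (suc (suc n))) = expand₃-⊕-coeff (tail f) (tail g) n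

  expand₃-⊕ : ∀ f g → expand₃ (f ⊕ g) ≈ expand₃ f ⊕ expand₃ g
  expand₃-⊕ f g = pointwise (expand₃-⊕-coeff f g)

  expand₃-·-coeff : ∀ f g n → expand₃ (f · g) n ≡ (expand₃ f · expand₃ g) n
  expand₃-·-coeff f g 0                   = refl
  expand₃-·-coeff f g 1                   = sym (trans (xor-identityʳ _) (∧-zeroʳ (f 0)))
  expand₃-·-coeff f g 2                   = sym (trans (xor-identityʳ _) (∧-zeroʳ (f 0)))
  expand₃-·-coeff f g (suc (suc (suc n))) = trans
    (expand₃-⊕-coeff (scale (f 0) (tail g)) (tail f · g) n)
    (cong₂ _xor_ (expand₃-scale (f 0) (tail g) n) (expand₃-·-coeff (tail f) g n))

expand₃-· : ∀ f g → expand₃ (f · g) ≈ expand₃ f · expand₃ g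
expand₃-· f g = pointwise (expand₃-·-coeff f g)

expand₃-3n : ∀ f n → expand₃ f (3 * n) ≡ f n
expand₃-3n f zero    = refl
expand₃-3n f (suc n) = trans (cong (expand₃ f) (*-suc 3 n)) (expand₃-3n (tail f) n)

expand₃-3n+1 : ∀ f n → expand₃ f (suc (3 * n)) ≡ false
expand₃-3n+1 f zero    = refl
expand₃-3n+1 f (suc n) = trans (cong (λ m → expand₃ f (suc m)) (*-suc 3 n)) (expand₃-3n+1 (tail f) n)

-- A factor that is a series in x³ preserves residue classes of exponents modulo 3, so extracting
-- the class of 1 acts on the other factor alone.
expand₃-·-3n+1 : ∀ f g n → (expand₃ f · g) (suc (3 * n)) ≡ (f · (λ k → g (suc (3 * k)))) n
expand₃-·-3n+1 f g zero    = xor-identityʳ (f 0 ∧ g 1)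
expand₃-·-3n+1 f g (suc n) = begin
  (expand₃ f · g) (suc (3 * suc n))   ≡⟨ cong (λ m → (expand₃ f · g) (suc m)) (*-suc 3 n) ⟩
  (f 0 ∧ g (suc (3 + 3 * n))) xor (expand₃ (tail f) · g) (suc (3 * n))
    ≡⟨ cong₂ (λ m s → (f 0 ∧ g (suc m)) xor s) (sym (*-suc 3 n)) (expand₃-·-3n+1 (tail f) g n) ⟩
  (f · (λ k → g (suc (3 * k)))) (suc n) ∎
  where open ≡-Reasoning

expand₃-cube : ∀ f → expand₃ (cube f) ≈ cube (expand₃ f)
expand₃-cube f = ≈-trans (expand₃-· (f · f) f) (·-cong (expand₃-· f f) ≈-refl)

-- Triangular numbers modulo 3

tri-double : ∀ n → tri n + tri n ≡ n * suc n
tri-double zero    = refl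
tri-double (suc n) = trans (e₁ n (tri n)) (trans (cong (suc n + suc n +_) (tri-double n)) (e₂ n))
  where
  e₁ : ∀ n t → (suc n + t) + (suc n + t) ≡ suc n + suc n + (t + t)
  e₁ = solve-∀
  e₂ : ∀ n → suc n + suc n + n * suc n ≡ suc n * suc (suc n)
  e₂ = solve-∀

-- Index 3n + 1 gives 9 times a triangular number plus 1; the other two classes give 3 times the
-- generalized pentagonal numbers. The three proofs form one recursion, each index resting on the
-- one before it.
tri-3n+1 : ∀ n → tri (suc (3 * n)) ≡ 3 * (3 * tri n) + 1
tri-3n+2 : ∀ n → tri (2 + 3 * n) ≡ 3 * (suc n * suc n + tri n)
tri-3n+3 : ∀ n → tri (3 + 3 * n) ≡ 3 * (suc n * suc n + tri (suc n))

tri-3n+1 zero    = refl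
tri-3n+1 (suc n) = begin
  tri (suc (3 * suc n))                                        ≡⟨ cong (λ m → tri (suc m)) (*-suc 3 n) ⟩
  4 + 3 * n + tri (3 + 3 * n)                                  ≡⟨ cong (4 + 3 * n +_) (tri-3n+3 n) ⟩
  4 + 3 * n + 3 * (suc n * suc n + (suc n + tri n))            ≡⟨ e₁ n (tri n) ⟩
  10 + 9 * n + 3 * (n * suc n) + 3 * tri n
    ≡⟨ cong (λ t → 10 + 9 * n + 3 * t + 3 * tri n) (sym (tri-double n)) ⟩
  10 + 9 * n + 3 * (tri n + tri n) + 3 * tri n                 ≡⟨ e₂ n (tri n) ⟩
  3 * (3 * tri (suc n)) + 1                                    ∎
  where
  open ≡-Reasoning
  e₁ : ∀ n t → 4 + 3 * n + 3 * (suc n * suc n + (suc n + t)) ≡ 10 + 9 * n + 3 * (n * suc n) + 3 * t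
  e₁ = solve-∀
  e₂ : ∀ n t → 10 + 9 * n + 3 * (t + t) + 3 * t ≡ 3 * (3 * (suc n + t)) + 1
  e₂ = solve-∀

tri-3n+2 n = begin
  2 + 3 * n + tri (suc (3 * n))              ≡⟨ cong (2 + 3 * n +_) (tri-3n+1 n) ⟩
  2 + 3 * n + (3 * (3 * tri n) + 1)          ≡⟨ e₁ n (tri n) ⟩
  3 + 3 * n + 3 * (tri n + tri n) + 3 * tri n ≡⟨ cong (λ t → 3 + 3 * n + 3 * t + 3 * tri n) (tri-double n) ⟩
  3 + 3 * n + 3 * (n * suc n) + 3 * tri n    ≡⟨ e₂ n (tri n) ⟩
  3 * (suc n * suc n + tri n)                ∎
  where
  open ≡-Reasoning
  e₁ : ∀ n t → 2 + 3 * n + (3 * (3 * t) + 1) ≡ 3 + 3 * n + 3 * (t + t) + 3 * t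
  e₁ = solve-∀
  e₂ : ∀ n t → 3 + 3 * n + 3 * (n * suc n) + 3 * t ≡ 3 * (suc n * suc n + t)
  e₂ = solve-∀

tri-3n+3 n = trans (cong (3 + 3 * n +_) (tri-3n+2 n)) (e n (tri n))
  where
  e : ∀ n t → 3 + 3 * n + 3 * (suc n * suc n + t) ≡ 3 * (suc n * suc n + (suc n + t))
  e = solve-∀

-- Among the indices 0 to 3n + 1, index 0 and the pairs 3j + 2, 3j + 3 with j < n form the
-- pentagonal part, and the indices 3j + 1 with j ≤ n form the triangular part. The bound 3n + 1
-- lets both parts end exactly.
triangularSum-dissection : ∀ n → triangularSum (suc (3 * n)) ≈
  expand₃ (pentagonalSum n) ⊕ expand₃ (expand₃ (triangularSum n)) · X^ 1
triangularSum-dissection zero = ⊕-cong (≈-sym (expand₃-X^ 0))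
  (≈-trans (≈-sym (𝟙· (X^ 1))) (·-cong (≈-sym (≈-trans (expand₃-cong (expand₃-X^ 0)) (expand₃-X^ 0))) ≈-refl))
triangularSum-dissection (suc n) = begin
  triangularSum (suc (3 * suc n))
    ≡⟨ cong (λ m → triangularSum (suc m)) (*-suc 3 n) ⟩
  triangularSum (suc (3 * n)) ⊕ X^ (tri (2 + 3 * n)) ⊕ X^ (tri (3 + 3 * n)) ⊕ X^ (tri (suc (3 + 3 * n)))
    ≈⟨ ⊕-cong (⊕-cong (⊕-cong (triangularSum-dissection n) (monomial p (tri-3n+2 n))) (monomial q (tri-3n+3 n)))
        last ⟩
  expand₃ P′ ⊕ expand₃ (expand₃ S) · x ⊕ expand₃ (X^ p) ⊕ expand₃ (X^ q) ⊕ expand₃ (expand₃ (X^ t)) · x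
    ≈⟨ solve 6 (λ P S p q t x → P :+ S :* x :+ p :+ q :+ t :* x := P :+ p :+ q :+ (S :+ t) :* x) ≈-refl
        (expand₃ P′) (expand₃ (expand₃ S)) (expand₃ (X^ p)) (expand₃ (X^ q)) (expand₃ (expand₃ (X^ t))) x ⟩
  expand₃ P′ ⊕ expand₃ (X^ p) ⊕ expand₃ (X^ q) ⊕ (expand₃ (expand₃ S) ⊕ expand₃ (expand₃ (X^ t))) · x
    ≈⟨ ⊕-cong (≈-trans (⊕-cong (≈-sym (expand₃-⊕ P′ (X^ p))) ≈-refl) (≈-sym (expand₃-⊕ (P′ ⊕ X^ p) (X^ q))))
              (·-cong (≈-sym (≈-trans (expand₃-cong (expand₃-⊕ S (X^ t)))
                  (expand₃-⊕ (expand₃ S) (expand₃ (X^ t))))) ≈-refl) ⟩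
  expand₃ (pentagonalSum (suc n)) ⊕ expand₃ (expand₃ (triangularSum (suc n))) · x ∎
  where
  open ≈-Reasoning
  open Solver₂
  x = X^ 1
  P′ = pentagonalSum n
  S = triangularSum n
  p = suc n * suc n + tri n
  q = suc n * suc n + tri (suc n)
  t = tri (suc n)
  monomial : ∀ {m} d → m ≡ 3 * d → X^ m ≈ expand₃ (X^ d)
  monomial d m≡3d = ≈-trans (X^≡ m≡3d) (≈-sym (expand₃-X^ d))
  last : X^ (tri (suc (3 + 3 * n))) ≈ expand₃ (expand₃ (X^ t)) · x
  last = ≈-trans (X^≡ (trans (cong (λ m → tri (suc m)) (sym (*-suc 3 n))) (tri-3n+1 (suc n))))
    (≈-trans (X^-+ (3 * (3 * t)) 1)
      (·-cong (≈-trans (monomial (3 * t) refl) (expand₃-cong (monomial t refl))) ≈-refl))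

cube-euler-dissection : cube euler ≈ expand₃ euler ⊕ expand₃ (expand₃ (cube euler)) · X^ 1
cube-euler-dissection = mod-⇒≈ λ K →
  mod-trans (mod-weaken (≤-trans (m≤n*m K 3) (n≤1+n (3 * K))) (cube-euler-triangular (suc (3 * K))))
  (mod-trans (≈⇒mod (triangularSum-dissection K))
    (mod-⊕ (mod-expand₃ (mod-sym (euler-pentagonal K)))
           (mod-· (mod-expand₃ (mod-expand₃ (mod-sym (cube-euler-triangular K)))) mod-refl)))

-- The modular equation

-- If f vanishes modulo x^K then so does f(x³), and the factor x raises the precision to K + 1.
fixed-by-expansion : ∀ f → f ≈ X^ 1 · expand₃ f → f ≈ 𝟘
fixed-by-expansion f p = mod-⇒≈ go
  where
  go : ∀ K → f ≈ 𝟘 mod K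
  go zero    = below λ _ ()
  go (suc K) = below λ where
    zero    _         → at p 0
    (suc i) (s≤s i<K) → trans (at p (suc i)) (trans (X^·-+ 1 (expand₃ f) i)
      (trans (coeff (mod-expand₃ (go K)) i i<K) (at expand₃-𝟘 i)))

fourth : Series₂ → Series₂
fourth f = f · f · (f · f)

expand₃-fourth : ∀ f → expand₃ (fourth f) ≈ fourth (expand₃ f)
expand₃-fourth f = ≈-trans (expand₃-· (f · f) (f · f)) (·-cong (expand₃-· f f) (expand₃-· f f))

⊕-zero⇒≈ : ∀ {f g} → f ⊕ g ≈ 𝟘 → f ≈ g
⊕-zero⇒≈ {f} {g} p = begin
  f               ≈⟨ solve 2 (λ f g → f := f :+ g :+ g) ≈-refl f g ⟩
  f ⊕ g ⊕ g       ≈⟨ ⊕-cong p ≈-refl ⟩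
  𝟘 ⊕ g           ≈⟨ ⊕-identityˡ g ⟩
  g               ∎
  where
  open ≈-Reasoning
  open Solver₂

ψ ψ₃ : Series₂
ψ  = cube euler
ψ₃ = expand₃ ψ

-- The defect D of this relation satisfies D = x D(x³): substitute ψ₉ x = ψ - euler(x³) in D(x³).
modular-equation : ψ · ψ₃ ≈ fourth ψ ⊕ X^ 1 · fourth ψ₃
modular-equation = ⊕-zero⇒≈ (fixed-by-expansion D (begin
  ψ · ψ₃ ⊕ (fourth ψ ⊕ x · fourth ψ₃)
    ≈⟨ ⊕-cong (·-cong cube-euler-dissection ψ₃≈g³) (⊕-cong (fourth-cong cube-euler-dissection)
        (·-cong ≈-refl (fourth-cong ψ₃≈g³))) ⟩
  a · cube g ⊕ (fourth a ⊕ x · fourth (cube g))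
    -- The fourth power of g + c x is g⁴ + c⁴ x⁴, and g · b is g⁴ as well. These two cancel, and
    -- everything left is divisible by x.
    ≈⟨ solve 3 (λ g c x →
        let a = g :+ c :* x ; b = g :* g :* g ; f₄ = λ u → u :* u :* (u :* u) in
        a :* b :+ (f₄ a :+ x :* f₄ b) := x :* (b :* c :+ (f₄ b :+ (x :* (x :* x)) :* f₄ c))) ≈-refl g ψ₉ x ⟩
  x · (cube g · ψ₉ ⊕ (fourth (cube g) ⊕ (x · (x · x)) · fourth ψ₉))
    ≈⟨ ·-cong ≈-refl (⊕-cong (·-cong (≈-sym ψ₃≈g³) ≈-refl)
        (⊕-cong (fourth-cong (≈-sym ψ₃≈g³)) (·-cong (≈-sym x³) ≈-refl))) ⟩
  x · (ψ₃ · ψ₉ ⊕ (fourth ψ₃ ⊕ expand₃ x · fourth ψ₉))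
    ≈⟨ ·-cong ≈-refl (≈-sym expanded) ⟩
  x · expand₃ D ∎))
  where
  open ≈-Reasoning
  open Solver₂
  x = X^ 1
  g = expand₃ euler
  ψ₉ = expand₃ ψ₃
  a = g ⊕ ψ₉ · x
  D = ψ · ψ₃ ⊕ (fourth ψ ⊕ x · fourth ψ₃)
  fourth-cong : ∀ {f g} → f ≈ g → fourth f ≈ fourth g
  fourth-cong p = ·-cong (·-cong p p) (·-cong p p)
  ψ₃≈g³ : ψ₃ ≈ cube g
  ψ₃≈g³ = expand₃-cube euler
  x³ : expand₃ x ≈ x · (x · x)
  x³ = ≈-trans (expand₃-X^ 1) (≈-trans (X^-+ 1 2) (·-cong ≈-refl (X^-+ 1 1)))
  expanded : expand₃ D ≈ ψ₃ · ψ₉ ⊕ (fourth ψ₃ ⊕ expand₃ x · fourth ψ₉)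
  expanded = ≈-trans (expand₃-⊕ (ψ · ψ₃) (fourth ψ ⊕ x · fourth ψ₃))
    (⊕-cong (expand₃-· ψ ψ₃) (≈-trans (expand₃-⊕ (fourth ψ) (x · fourth ψ₃))
      (⊕-cong (expand₃-fourth ψ) (≈-trans (expand₃-· x (fourth ψ₃)) (·-cong ≈-refl (expand₃-fourth ψ₃))))))

-- Integers and integer series modulo 2

odd : ℕ → Bool
odd zero    = false
odd (suc n) = not (odd n)

odd-+ : ∀ m n → odd (m + n) ≡ odd m xor odd n
odd-+ zero    n = refl
odd-+ (suc m) n = trans (cong not (odd-+ m n)) (not-distribˡ-xor (odd m) (odd n))

odd-* : ∀ m n → odd (m * n) ≡ odd m ∧ odd n
odd-* zero    n = refl
odd-* (suc m) n = trans (odd-+ n (m * n)) (trans (cong (odd n xor_) (odd-* m n)) (sym (step (odd m) (odd n))))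
  where
  step : ∀ a b → not a ∧ b ≡ b xor (a ∧ b)
  step false false = refl
  step false true  = refl
  step true  false = refl
  step true  true  = refl

odd-∣⊖∣ : ∀ m n → odd ∣ m ⊖ n ∣ ≡ odd m xor odd n
odd-∣⊖∣ zero    zero    = refl
odd-∣⊖∣ zero    (suc n) = refl
odd-∣⊖∣ (suc m) zero    = sym (xor-identityʳ (odd (suc m)))
odd-∣⊖∣ (suc m) (suc n) = trans (cong (λ i → odd ∣ i ∣) (ℤ.[1+m]⊖[1+n]≡m⊖n m n))
  (trans (odd-∣⊖∣ m n) (sym (xor-annihilates-not (odd m) (odd n))))

parity : ℤ → Bool
parity i = odd ∣ i ∣

parity-+ : ∀ i j → parity (i ℤ.+ j) ≡ parity i xor parity j
parity-+ (ℤ.+ m)     (ℤ.+ n)     = odd-+ m n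
parity-+ (ℤ.+ m)     -[1+ n ]  = odd-∣⊖∣ m (suc n)
parity-+ -[1+ m ]  (ℤ.+ n)     = trans (odd-∣⊖∣ n (suc m)) (xor-comm (odd n) (odd (suc m)))
parity-+ -[1+ m ]  -[1+ n ]  = trans (cong odd (cong suc (sym (+-suc m n)))) (odd-+ (suc m) (suc n))

parity-* : ∀ i j → parity (i ℤ.* j) ≡ parity i ∧ parity j
parity-* i j = trans (cong odd (ℤ.abs-* i j)) (odd-* ∣ i ∣ ∣ j ∣)

odd-false⇒even : ∀ n → odd n ≡ false → 2 ∣ n
odd-false⇒even zero          _ = divides 0 refl
odd-false⇒even (suc (suc n)) p with odd-false⇒even n (trans (sym (not-involutive (odd n))) p)
... | divides q n≡q*2 = divides (suc q) (cong (λ i → suc (suc i)) n≡q*2)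

reduce : Series → Series₂
reduce f n = parity (f n)

sumTo-suc : ∀ n h → sumTo (suc n) h ≡ h 0 ℤ.+ sumTo n (λ k → h (suc k))
sumTo-suc zero    h = refl
sumTo-suc (suc n) h = trans (cong (ℤ._+ h (suc (suc n))) (sumTo-suc n h)) (ℤ.+-assoc (h 0) _ _)

reduce-⊛ : ∀ f g → reduce (f ⊛ g) ≈ reduce f · reduce g
reduce-⊛ f g = pointwise (go f)
  where
  go : ∀ f n → reduce (f ⊛ g) n ≡ (reduce f · reduce g) n
  go f zero    = parity-* (f 0) (g 0)
  go f (suc n) = begin
    parity ((f ⊛ g) (suc n))
      ≡⟨ cong parity (sumTo-suc n (λ k → f k ℤ.* g (suc n ∸ k))) ⟩
    parity (f 0 ℤ.* g (suc n) ℤ.+ (f′ ⊛ g) n)        ≡⟨ parity-+ (f 0 ℤ.* g (suc n)) ((f′ ⊛ g) n) ⟩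
    parity (f 0 ℤ.* g (suc n)) xor parity ((f′ ⊛ g) n) ≡⟨ cong₂ _xor_ (parity-* (f 0) (g (suc n))) (go f′ n) ⟩
    (reduce f · reduce g) (suc n)                    ∎
    where
    open ≡-Reasoning
    f′ : Series
    f′ k = f (suc k)

reduce-oneS : reduce oneS ≈ 𝟙
reduce-oneS = pointwise λ { zero → refl ; (suc n) → refl }

X^-≢ : ∀ {d n} → n ≢ d → X^ d n ≡ false
X^-≢ {d} {n} n≢d with X^ d n in eq
... | true  = ⊥-elim (n≢d (X^-true d n eq))
... | false = refl

reduce-oneMinusQ : ∀ d → reduce (oneMinusQ (suc d)) ≈ 1+X^ (suc d)
reduce-oneMinusQ d = pointwise λ k → trans (go k) (sym (⊕-coeff 𝟙 (X^ (suc d)) k))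
  where
  go : ∀ k → parity (oneMinusQ (suc d) k) ≡ 𝟙 k xor X^ (suc d) k
  go k with k ≟ 0 | k ≟ suc d
  ... | yes refl | _        = refl
  ... | no  k≢0  | yes refl = sym (X^-self d)
  go zero    | no k≢0 | no k≢d = ⊥-elim (k≢0 refl)
  go (suc k) | no k≢0 | no k≢d = sym (X^-≢ k≢d)

reduce-geomQ : ∀ d → reduce (geomQ d) ≈ geom d
reduce-geomQ d = pointwise go
  where
  go : ∀ k → parity (geomQ d k) ≡ geom d k
  go k with does (d ∣? k)
  ... | true  = refl
  ... | false = refl

power : Series₂ → ℕ → Series₂
power f zero    = 𝟙
power f (suc e) = f · power f e

power-cong : ∀ {f g} e → f ≈ g → power f e ≈ power g e
power-cong zero    p = ≈-refl
power-cong (suc e) p = ·-cong p (power-cong e p)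

mod-power : ∀ {f g K} e → f ≈ g mod K → power f e ≈ power g e mod K
mod-power zero    p = mod-refl
mod-power (suc e) p = mod-· p (mod-power e p)

power-· : ∀ f g e → power (f · g) e ≈ power f e · power g e
power-· f g zero    = ≈-sym (𝟙· 𝟙)
power-· f g (suc e) = ≈-trans (·-cong ≈-refl (power-· f g e)) (swap-middle f g (power f e) (power g e))

power-𝟙 : ∀ e → power 𝟙 e ≈ 𝟙
power-𝟙 zero    = ≈-refl
power-𝟙 (suc e) = ≈-trans (𝟙· (power 𝟙 e)) (power-𝟙 e)

power-inverse : ∀ {f g} e → f · g ≈ 𝟙 → power f e · power g e ≈ 𝟙
power-inverse {f} {g} e fg≈𝟙 = ≈-trans (≈-sym (power-· f g e)) (≈-trans (power-cong e fg≈𝟙) (power-𝟙 e))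

reduce-powS : ∀ f e → reduce (powS f e) ≈ power (reduce f) e
reduce-powS f zero    = reduce-oneS
reduce-powS f (suc e) = ≈-trans (reduce-⊛ f (powS f e)) (·-cong ≈-refl (reduce-powS f e))

reduce-prodS : ∀ n F → reduce (prodS n F) ≈ ∏ n (λ i → reduce (F i))
reduce-prodS zero    F = reduce-oneS
reduce-prodS (suc n) F = ≈-trans (reduce-⊛ (F (suc n)) (prodS n F)) (·-cong ≈-refl (reduce-prodS n F))

-- The eta quotient modulo 2

etaFactor : ℕ → Series₂
etaFactor n = 1+X^ n · 1+X^ (3 * n)

-- Modulo 2 the denominators 1 - x^(2n) and 1 - x^(6n) are the squares of the numerators, so each
-- quotient is the inverse of its numerator.
PFactor-inverse : ∀ n → reduce (PFactor (suc n)) · power (etaFactor (suc n)) 6 ≈ 𝟙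
PFactor-inverse n = ≈-trans (·-cong (reduce-powS base 6) ≈-refl) (power-inverse 6 (begin
  reduce base · (u · v)              ≈⟨ ·-cong reduced ≈-refl ⟩
  u · (v · (g₂ · g₆)) · (u · v)
    ≈⟨ solve 4 (λ u v g₂ g₆ → u :* (v :* (g₂ :* g₆)) :* (u :* v) := u :* u :* g₂ :* (v :* v :* g₆)) ≈-refl u v
        g₂ g₆ ⟩
  u · u · g₂ · (v · v · g₆)
    ≈⟨ ·-cong (·-cong (≈-sym (1+X^-double (suc n))) ≈-refl) (·-cong (≈-sym 6=2*3) ≈-refl) ⟩
  1+X^ (2 * suc n) · g₂ · (1+X^ (6 * suc n) · g₆) ≈⟨ ·-cong (geom-inverse (n + suc (n + 0))) (geom-inverse _) ⟩
  𝟙 · 𝟙                              ≈⟨ 𝟙· 𝟙 ⟩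
  𝟙                                  ∎))
  where
  open ≈-Reasoning
  open Solver₂
  base = oneMinusQ (suc n) ⊛ (oneMinusQ (3 * suc n) ⊛ (geomQ (2 * suc n) ⊛ geomQ (6 * suc n)))
  u = 1+X^ (suc n)
  v = 1+X^ (3 * suc n)
  g₂ = geom (2 * suc n)
  g₆ = geom (6 * suc n)
  reduced : reduce base ≈ u · (v · (g₂ · g₆))
  reduced = ≈-trans (reduce-⊛ (oneMinusQ (suc n)) (oneMinusQ (3 * suc n) ⊛
      (geomQ (2 * suc n) ⊛ geomQ (6 * suc n)))) (·-cong (reduce-oneMinusQ n)
    (≈-trans (reduce-⊛ (oneMinusQ (3 * suc n)) (geomQ (2 * suc n) ⊛ geomQ (6 * suc n)))
        (·-cong (reduce-oneMinusQ _)
      (≈-trans (reduce-⊛ (geomQ (2 * suc n)) (geomQ (6 * suc n)))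
          (·-cong (reduce-geomQ (2 * suc n)) (reduce-geomQ (6 * suc n)))))))
  e : ∀ n → 6 * suc n ≡ 2 * (3 * suc n)
  e = solve-∀
  6=2*3 : 1+X^ (6 * suc n) ≈ v · v
  6=2*3 = ≈-trans (⊕-cong ≈-refl (X^≡ (e n))) (1+X^-double (3 * suc n))

etaFactor≈𝟙 : ∀ n → etaFactor (suc n) ≈ 𝟙 mod suc n
etaFactor≈𝟙 n = mod-trans (mod-· (1+X^≈𝟙 n) (mod-weaken (m≤n*m (suc n) 3) (1+X^≈𝟙 _))) (≈⇒mod (𝟙· 𝟙))

-- Transferred from the inverse: if b ≡ 1 and a b = 1, then a ≡ a b = 1.
PFactor≈𝟙 : ∀ n → reduce (PFactor (suc n)) ≈ 𝟙 mod suc n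
PFactor≈𝟙 n = mod-trans (≈⇒mod (≈-sym (·𝟙 (reduce (PFactor (suc n))))))
  (mod-trans (mod-· mod-refl (mod-sym (mod-trans (mod-power 6 (etaFactor≈𝟙 n)) (≈⇒mod (power-𝟙 6)))))
             (≈⇒mod (PFactor-inverse n)))

∏-power : ∀ n F e → ∏ n (λ i → power (F i) e) ≈ power (∏ n F) e
∏-power zero    F e = ≈-sym (power-𝟙 e)
∏-power (suc n) F e = ≈-trans (·-cong ≈-refl (∏-power n F e)) (≈-sym (power-· (F (suc n)) (∏ n F) e))

∏-etaFactor : ∀ n → ∏ n etaFactor ≈ eulerUpTo n · expand₃ (eulerUpTo n)
∏-etaFactor zero    = ≈-trans (≈-sym (expand₃-X^ 0)) (≈-sym (𝟙· (expand₃ 𝟙)))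
∏-etaFactor (suc n) = begin
  1+X^ (suc n) · 1+X^ (3 * suc n) · ∏ n etaFactor
    ≈⟨ ·-cong (·-cong ≈-refl (≈-sym expanded)) (∏-etaFactor n) ⟩
  1+X^ (suc n) · expand₃ (1+X^ (suc n)) · (eulerUpTo n · expand₃ (eulerUpTo n))
    ≈⟨ swap-middle (1+X^ (suc n)) _ _ _ ⟩
  1+X^ (suc n) · eulerUpTo n · (expand₃ (1+X^ (suc n)) · expand₃ (eulerUpTo n))
    ≈⟨ ·-cong ≈-refl (≈-sym (expand₃-· (1+X^ (suc n)) (eulerUpTo n))) ⟩
  eulerUpTo (suc n) · expand₃ (eulerUpTo (suc n)) ∎
  where
  open ≈-Reasoning
  expanded : expand₃ (1+X^ (suc n)) ≈ 1+X^ (3 * suc n)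
  expanded = ≈-trans (expand₃-⊕ 𝟙 (X^ (suc n))) (⊕-cong (expand₃-X^ 0) (expand₃-X^ (suc n)))

reduce-P-inverse : reduce P · power (euler · expand₃ euler) 6 ≈ 𝟙
reduce-P-inverse = mod-⇒≈ λ K → mod-weaken (n≤1+n K) (mod-trans
  -- `P` reads its k-th coefficient off the k-th partial product, so its reduction is literally a
  -- `∏∞`, once `reduce-prodS` is applied at each k.
  (mod-· (mod-trans (≈⇒mod (pointwise λ k → at (reduce-prodS k PFactor) k))
      (∏∞-approx (λ i → reduce (PFactor i)) PFactor≈𝟙 K))
         (mod-trans (mod-power 6 (mod-· (euler≈eulerUpTo K) (mod-expand₃ (euler≈eulerUpTo K))))
                    (≈⇒mod (≈-sym (≈-trans (∏-power K etaFactor 6) (power-cong 6 (∏-etaFactor K)))))))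
  (≈⇒mod (∏-inverse (λ i → reduce (PFactor i)) (λ i → power (etaFactor i) 6) PFactor-inverse K)))

P-ψ : reduce P · (ψ · ψ₃) · (ψ · ψ₃) ≈ 𝟙
P-ψ = begin
  reduce P · (ψ · ψ₃) · (ψ · ψ₃)
    ≈⟨ ·-cong (·-cong ≈-refl (·-cong ≈-refl (expand₃-cube euler))) (·-cong ≈-refl (expand₃-cube euler)) ⟩
  reduce P · (cube f · cube g) · (cube f · cube g)
    ≈⟨ solve 3 (λ p f g → let w = f :* g ; c = f :* f :* f :* (g :* g :* g) in
         p :* c :* c := p :* (w :* (w :* (w :* (w :* (w :* (w :* con true))))))) ≈-refl (reduce P) f g ⟩
  reduce P · power (f · g) 6         ≈⟨ reduce-P-inverse ⟩
  𝟙                                  ∎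
  where
  open ≈-Reasoning
  open Solver₂
  f = euler
  g = expand₃ euler

-- The inverse of ψ · ψ₃, by `P-ψ`. Multiplying the inverse of the square by ψ · ψ₃ yields it
-- without constructing any inverse series.
γ : Series₂
γ = reduce P · (ψ · ψ₃)

P-square : reduce P ≈ γ · γ
P-square = begin
  reduce P                                          ≈⟨ ≈-sym (·𝟙 _) ⟩
  reduce P · 𝟙                                      ≈⟨ ·-cong ≈-refl (≈-sym P-ψ) ⟩
  reduce P · (reduce P · (ψ · ψ₃) · (ψ · ψ₃))
    ≈⟨ solve 2 (λ p w → p :* (p :* w :* w) := p :* w :* (p :* w)) ≈-refl (reduce P) (ψ · ψ₃) ⟩
  γ · γ                                             ∎
  where
  open ≈-Reasoning
  open Solver₂

-- Even and odd parts

∧-∧-cancel : ∀ a b s → (a ∧ b) xor (s xor (b ∧ a)) ≡ s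
∧-∧-cancel a b s = begin
  (a ∧ b) xor (s xor (b ∧ a))
    ≡⟨ cong ((a ∧ b) xor_) (trans (xor-comm s (b ∧ a)) (cong (_xor s) (∧-comm b a))) ⟩
  (a ∧ b) xor ((a ∧ b) xor s)   ≡⟨ sym (xor-assoc (a ∧ b) (a ∧ b) s) ⟩
  ((a ∧ b) xor (a ∧ b)) xor s   ≡⟨ cong (_xor s) (xor-same (a ∧ b)) ⟩
  s                             ∎
  where open ≡-Reasoning

-- The outer product of f(0) and f(n + 2) occurs twice and cancels; this is f² = f(0)² + x²
-- (`tail f`)² coefficientwise, and iterating it shows that squaring replaces x by x².
square-suc-suc : ∀ f n → (f · f) (2 + n) ≡ (tail f · tail f) n
square-suc-suc f n = trans (cong ((f 0 ∧ f (2 + n)) xor_) (·-suc (tail f) f n)) (∧-∧-cancel (f 0) (f (2 + n)) _)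

square-even : ∀ f n → (f · f) (2 * n) ≡ f n
square-even f zero    = ∧-idem (f 0)
square-even f (suc n) = trans (cong (f · f) (*-suc 2 n))
    (trans (square-suc-suc f (2 * n)) (square-even (tail f) n))

square-odd : ∀ f n → (f · f) (suc (2 * n)) ≡ false
square-odd f zero    = ∧-∧-cancel (f 0) (f 1) false
square-odd f (suc n) = trans (cong (λ m → (f · f) (suc m)) (*-suc 2 n))
    (trans (square-suc-suc f (suc (2 * n))) (square-odd (tail f) n))

dissect-even : ∀ {f g h} → f ≈ g · g ⊕ X^ 1 · (h · h) → ∀ n → f (2 * n) ≡ g n
dissect-even {f} {g} {h} p n = begin
  f (2 * n)                                    ≡⟨ at p (2 * n) ⟩
  (g · g ⊕ X^ 1 · (h · h)) (2 * n)             ≡⟨ ⊕-coeff (g · g) _ (2 * n) ⟩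
  (g · g) (2 * n) xor (X^ 1 · (h · h)) (2 * n) ≡⟨ cong₂ _xor_ (square-even g n) (shifted n) ⟩
  g n xor false                                ≡⟨ xor-identityʳ (g n) ⟩
  g n                                          ∎
  where
  open ≡-Reasoning
  shifted : ∀ n → (X^ 1 · (h · h)) (2 * n) ≡ false
  shifted zero    = refl
  shifted (suc n) = trans (cong (X^ 1 · (h · h)) (*-suc 2 n))
      (trans (X^·-+ 1 (h · h) (suc (2 * n))) (square-odd h n))

dissect-odd : ∀ {f g h} → f ≈ g · g ⊕ X^ 1 · (h · h) → ∀ n → f (suc (2 * n)) ≡ h n
dissect-odd {f} {g} {h} p n = begin
  f (suc (2 * n))                                          ≡⟨ at p (suc (2 * n)) ⟩
  (g · g ⊕ X^ 1 · (h · h)) (suc (2 * n))                   ≡⟨ ⊕-coeff (g · g) _ (suc (2 * n)) ⟩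
  (g · g) (suc (2 * n)) xor (X^ 1 · (h · h)) (suc (2 * n))
    ≡⟨ cong₂ _xor_ (square-odd g n) (X^·-+ 1 (h · h) (2 * n)) ⟩
  (h · h) (2 * n)                                          ≡⟨ square-even h n ⟩
  h n                                                      ∎
  where open ≡-Reasoning

-- Inserting γ · (ψ · ψ₃) = 1 creates a factor γ², and the modular equation turns ψ · ψ₃ into a
-- fourth power plus x times a fourth power; each summand is then a square, up to x.
γ-dissection : γ ≈ γ · (ψ · ψ) · (γ · (ψ · ψ)) ⊕ X^ 1 · (γ · (ψ₃ · ψ₃) · (γ · (ψ₃ · ψ₃)))
γ-dissection = begin
  γ                                      ≈⟨ ≈-sym (·𝟙 γ) ⟩
  γ · 𝟙                                  ≈⟨ ·-cong ≈-refl (≈-sym P-ψ) ⟩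
  γ · (γ · (ψ · ψ₃))                     ≈⟨ ·-cong ≈-refl (·-cong ≈-refl modular-equation) ⟩
  γ · (γ · (fourth ψ ⊕ X^ 1 · fourth ψ₃))
    ≈⟨ solve 4 (λ γ a b x → γ :* (γ :* (a :* a :* (a :* a) :+ x :* (b :* b :* (b :* b))))
                 := γ :* (a :* a) :* (γ :* (a :* a)) :+ x :* (γ :* (b :* b) :* (γ :* (b :* b)))) ≈-refl γ ψ ψ₃
                     (X^ 1) ⟩
  γ · (ψ · ψ) · (γ · (ψ · ψ)) ⊕ X^ 1 · (γ · (ψ₃ · ψ₃) · (γ · (ψ₃ · ψ₃))) ∎
  where
  open ≈-Reasoning
  open Solver₂

-- The same insertion. The square part is now (γ ψ ψ₃)² ψ², in which γ cancels completely; this is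
-- where ψ itself emerges as an even part.
γψ₃²-dissection : γ · (ψ₃ · ψ₃) ≈ ψ · ψ ⊕ X^ 1 · (γ · cube ψ₃ · (γ · cube ψ₃))
γψ₃²-dissection = begin
  γ · (ψ₃ · ψ₃)                                 ≈⟨ ≈-sym (·𝟙 _) ⟩
  γ · (ψ₃ · ψ₃) · 𝟙                             ≈⟨ ·-cong ≈-refl (≈-sym P-ψ) ⟩
  γ · (ψ₃ · ψ₃) · (γ · (ψ · ψ₃))                ≈⟨ ·-cong ≈-refl (·-cong ≈-refl modular-equation) ⟩
  γ · (ψ₃ · ψ₃) · (γ · (fourth ψ ⊕ X^ 1 · fourth ψ₃))
    ≈⟨ solve 4 (λ γ a b x → γ :* (b :* b) :* (γ :* (a :* a :* (a :* a) :+ x :* (b :* b :* (b :* b))))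
         := γ :* (a :* b) :* (γ :* (a :* b)) :* (a :* a) :+ x :* (γ :* (b :* b :* b) :* (γ :* (b :* b :* b))))
             ≈-refl γ ψ ψ₃ (X^ 1) ⟩
  γ · (ψ · ψ₃) · (γ · (ψ · ψ₃)) · (ψ · ψ) ⊕ X^ 1 · (γ · cube ψ₃ · (γ · cube ψ₃))
    ≈⟨ ⊕-cong (≈-trans (·-cong (·-cong P-ψ P-ψ) ≈-refl) (absorb _ (𝟙· 𝟙))) ≈-refl ⟩
  ψ · ψ ⊕ X^ 1 · (γ · cube ψ₃ · (γ · cube ψ₃)) ∎
  where
  open ≈-Reasoning
  open Solver₂

-- Both sides are the inverse of ψ₃, since γ · ψ₃ is the inverse of ψ. Hence γ · ψ is a series in
-- x³, which opens the way to extracting a residue class modulo 3.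
γψ≈expand₃ : γ · ψ ≈ expand₃ (γ · ψ₃)
γψ≈expand₃ = begin
  γ · ψ                                    ≈⟨ ≈-sym (absorb (γ · ψ) inverse) ⟩
  expand₃ (γ · ψ₃) · ψ₃ · (γ · ψ)
    ≈⟨ solve 4 (λ e b γ a → e :* b :* (γ :* a) := γ :* (a :* b) :* e) ≈-refl (expand₃ (γ · ψ₃)) ψ₃ γ ψ ⟩
  γ · (ψ · ψ₃) · expand₃ (γ · ψ₃)          ≈⟨ absorb _ P-ψ ⟩
  expand₃ (γ · ψ₃)                         ∎
  where
  open ≈-Reasoning
  open Solver₂
  inverse : expand₃ (γ · ψ₃) · ψ₃ ≈ 𝟙
  inverse = ≈-trans (≈-sym (expand₃-· (γ · ψ₃) ψ)) (≈-trans (expand₃-cong (≈-trans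
    (solve 3 (λ γ a b → γ :* b :* a := γ :* (a :* b)) ≈-refl γ ψ ψ₃) P-ψ)) (expand₃-X^ 0))

-- In ψ = f(x³) + x ψ(x⁹) only the second summand has exponents congruent to 1 modulo 3.
ψ-3n+1 : ∀ n → ψ (suc (3 * n)) ≡ ψ₃ n
ψ-3n+1 n = begin
  ψ (suc (3 * n))                                            ≡⟨ at cube-euler-dissection (suc (3 * n)) ⟩
  (expand₃ euler ⊕ expand₃ ψ₃ · X^ 1) (suc (3 * n))
    ≡⟨ ⊕-coeff (expand₃ euler) (expand₃ ψ₃ · X^ 1) (suc (3 * n)) ⟩
  expand₃ euler (suc (3 * n)) xor (expand₃ ψ₃ · X^ 1) (suc (3 * n))
    ≡⟨ cong₂ _xor_ (expand₃-3n+1 euler n) (trans (·-comm (expand₃ ψ₃) (X^ 1) (suc (3 * n)))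
        (X^·-+ 1 (expand₃ ψ₃) (3 * n))) ⟩
  expand₃ ψ₃ (3 * n)                                         ≡⟨ expand₃-3n ψ₃ n ⟩
  ψ₃ n                                                       ∎
  where open ≡-Reasoning

γψ₃²-even : ∀ n → (γ · (ψ₃ · ψ₃)) (2 * n) ≡ ψ n
γψ₃²-even = dissect-even γψ₃²-dissection

-- Read γ ψ² as (γ ψ) · ψ: the first factor is a series in x³, so extraction turns it into γ · ψ₃
-- and turns ψ into ψ₃. The case m = 1 thereby joins the case m = 0.
γψ²-3n+1 : ∀ n → (γ · (ψ · ψ)) (suc (3 * n)) ≡ (γ · (ψ₃ · ψ₃)) n
γψ²-3n+1 n = begin
  (γ · (ψ · ψ)) (suc (3 * n))                     ≡⟨ sym (·-assoc γ ψ ψ (suc (3 * n))) ⟩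
  (γ · ψ · ψ) (suc (3 * n))                       ≡⟨ at (·-cong γψ≈expand₃ (≈-refl {ψ})) (suc (3 * n)) ⟩
  (expand₃ (γ · ψ₃) · ψ) (suc (3 * n))            ≡⟨ expand₃-·-3n+1 (γ · ψ₃) ψ n ⟩
  (γ · ψ₃ · (λ k → ψ (suc (3 * k)))) n            ≡⟨ at (·-cong (≈-refl {γ · ψ₃}) (pointwise ψ-3n+1)) n ⟩
  (γ · ψ₃ · ψ₃) n                                 ≡⟨ ·-assoc γ ψ₃ ψ₃ n ⟩
  (γ · (ψ₃ · ψ₃)) n                               ∎
  where open ≡-Reasoning

-- Parity of the coefficients of j₆*

parity-J6* : ∀ n → parity (J6* n) ≡ reduce P (suc n)
parity-J6* n = trans (parity-+ (P (suc n)) (ℤ.+ 64 ℤ.* Pinv (n ∸ 1)))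
  (trans (cong (parity (P (suc n)) xor_) (parity-* (ℤ.+ 64) (Pinv (n ∸ 1)))) (xor-identityʳ _))

reduce-P-even : ∀ n → reduce P (2 * n) ≡ γ n
reduce-P-even n = trans (at P-square (2 * n)) (square-even γ n)

-- For m = 0 the index in P is 8n + 2 = 2(4n + 1): halve it, take the odd part at 2(2n) + 1, then
-- the even part at 2n. For m = 1 it is 24n + 4 = 4(6n + 1): halve it, take the even part, then the
-- class of 1 modulo 3 at 3(2n) + 1, and again the even part at 2n.
J6*-parity : ∀ {m} → m ≤ 1 → ∀ n → parity (J6* (3 ^ m * (8 * n + 1))) ≡ ψ n
J6*-parity {0} _ n = begin
  parity (J6* (1 * (8 * n + 1)))         ≡⟨ parity-J6* (1 * (8 * n + 1)) ⟩
  reduce P (suc (1 * (8 * n + 1)))       ≡⟨ cong (reduce P) (e n) ⟩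
  reduce P (2 * suc (2 * (2 * n)))       ≡⟨ reduce-P-even (suc (2 * (2 * n))) ⟩
  γ (suc (2 * (2 * n)))                  ≡⟨ dissect-odd γ-dissection (2 * n) ⟩
  (γ · (ψ₃ · ψ₃)) (2 * n)                ≡⟨ γψ₃²-even n ⟩
  ψ n                                    ∎
  where
  open ≡-Reasoning
  e : ∀ n → suc (1 * (8 * n + 1)) ≡ 2 * suc (2 * (2 * n))
  e = solve-∀
J6*-parity {1} _ n = begin
  parity (J6* (3 * (8 * n + 1)))           ≡⟨ parity-J6* (3 * (8 * n + 1)) ⟩
  reduce P (suc (3 * (8 * n + 1)))         ≡⟨ cong (reduce P) (e n) ⟩
  reduce P (2 * (2 * suc (3 * (2 * n))))   ≡⟨ reduce-P-even (2 * suc (3 * (2 * n))) ⟩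
  γ (2 * suc (3 * (2 * n)))                ≡⟨ dissect-even γ-dissection (suc (3 * (2 * n))) ⟩
  (γ · (ψ · ψ)) (suc (3 * (2 * n)))        ≡⟨ γψ²-3n+1 (2 * n) ⟩
  (γ · (ψ₃ · ψ₃)) (2 * n)                  ≡⟨ γψ₃²-even n ⟩
  ψ n                                      ∎
  where
  open ≡-Reasoning
  e : ∀ n → suc (3 * (8 * n + 1)) ≡ 2 * (2 * suc (3 * (2 * n)))
  e = solve-∀
J6*-parity {suc (suc m)} (s≤s ()) n

-- Counting odd coefficients and the density

bit : Bool → ℕ
bit b = if b then 1 else 0

bit-xor : ∀ a b → bit (a xor b) ≤ bit a + bit b
bit-xor false b     = ≤-refl
bit-xor true  false = ≤-refl
bit-xor true  true  = z≤n

-- The constant coefficient is not counted.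
ones : Series₂ → ℕ → ℕ
ones f zero    = 0
ones f (suc X) = ones f X + bit (f (suc X))

ones-local : ∀ {f g} X → (∀ i → i ≤ X → f i ≡ g i) → ones f X ≡ ones g X
ones-local zero    p = refl
ones-local (suc X) p = cong₂ _+_ (ones-local X λ i i≤X → p i (m≤n⇒m≤1+n i≤X)) (cong bit (p (suc X) ≤-refl))

ones-⊕ : ∀ f g X → ones (f ⊕ g) X ≤ ones f X + ones g X
ones-⊕ f g zero    = z≤n
ones-⊕ f g (suc X) = begin
  ones (f ⊕ g) X + bit ((f ⊕ g) (suc X))
    ≡⟨ cong (λ b → ones (f ⊕ g) X + bit b) (⊕-coeff f g (suc X)) ⟩
  ones (f ⊕ g) X + bit (f (suc X) xor g (suc X))
    ≤⟨ +-mono-≤ (ones-⊕ f g X) (bit-xor (f (suc X)) (g (suc X))) ⟩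
  ones f X + ones g X + (bit (f (suc X)) + bit (g (suc X)))      ≡⟨ e (ones f X) (ones g X) _ _ ⟩
  ones f (suc X) + ones g (suc X)                                ∎
  where
  open ≤-Reasoning
  e : ∀ a b c d → a + b + (c + d) ≡ a + c + (b + d)
  e = solve-∀

ones-X^ : ∀ d X → ones (X^ d) X ≤ 1
ones-X^ d zero    = z≤n
ones-X^ d (suc X) with X^ d (suc X) in eq
... | false = ≤-trans (≤-reflexive (+-identityʳ _)) (ones-X^ d X)
... | true with X^-true d (suc X) eq
...   | refl = ≤-reflexive (cong (_+ 1) (none X ≤-refl))
  where
  none : ∀ Y → Y ≤ X → ones (X^ (suc X)) Y ≡ 0
  none zero    _   = refl
  none (suc Y) Y<X = cong₂ (λ a b → a + bit b) (none Y (≤-trans (n≤1+n Y) Y<X))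
      (coeff (X^≈𝟘 ≤-refl) (suc Y) (s≤s Y<X))

ones-triangularSum : ∀ J X → ones (triangularSum J) X ≤ suc J
ones-triangularSum zero    X = ones-X^ 0 X
ones-triangularSum (suc J) X = ≤-trans (ones-⊕ (triangularSum J) (X^ (tri (suc J))) X)
  (≤-trans (+-mono-≤ (ones-triangularSum J X) (ones-X^ (tri (suc J)) X)) (≤-reflexive (+-comm (suc J) 1)))

ones-ψ : ∀ {X} J → X < tri (suc J) → ones ψ X ≤ suc J
ones-ψ {X} J X<t = ≤-trans (≤-reflexive (ones-local X λ i i≤X → coeff ψ≈ i (≤-<-trans i≤X X<t)))
    (ones-triangularSum J X)
  where
  t = tri (suc J)
  ψ≈ : ψ ≈ triangularSum J mod t
  -- The length t + J serves both sides: it gives precision at least t, and it has the form to which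
  -- `triangularSum-stable` applies. The summands dropped have degree at least t.
  ψ≈ = mod-trans (mod-weaken (m≤m+n t J) (cube-euler-triangular (t + J))) (triangularSum-stable t J)

triangular-root : ∀ X → ∃[ J ] (tri J ≤ X × X < tri (suc J))
triangular-root zero    = 0 , z≤n , z<s
triangular-root (suc X) with triangular-root X
... | J , t≤X , X<t with suc X <? tri (suc J)
...   | yes 1+X<t = J , ≤-trans t≤X (n≤1+n X) , 1+X<t
...   | no  1+X≮t = suc J , ≮⇒≥ 1+X≮t , ≤-<-trans X<t (s≤s (m≤n+m (tri (suc J)) (suc J)))

-- Each n from 1 to X is caught by the filter or contributes to `ones f X`, so a lower bound for the
-- filter needs only an upper bound for `ones`.
length-filter-≥ : ∀ {Q : ℕ → Set} (Q? : Decidable Q) f → (∀ n → f n ≡ false → Q n) →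
  ∀ X → X ≤ length (filter Q? (map suc (upTo X))) + ones f X
length-filter-≥ Q? f f-false⇒Q zero    = z≤n
length-filter-≥ Q? f f-false⇒Q (suc X) = begin
  suc X                                          ≡⟨ +-comm 1 X ⟩
  X + 1                                          ≤⟨ +-mono-≤ (length-filter-≥ Q? f f-false⇒Q X) last ⟩
  count X + ones f X + (c + bit (f (suc X)))     ≡⟨ e (count X) (ones f X) c _ ⟩
  count X + c + ones f (suc X)                   ≡⟨ cong (_+ ones f (suc X)) (sym split) ⟩
  count (suc X) + ones f (suc X)                 ∎
  where
  open ≤-Reasoning
  count : ℕ → ℕ
  count Y = length (filter Q? (map suc (upTo Y)))
  c = length (filter Q? (suc X ∷ []))
  e : ∀ a b c d → a + b + (c + d) ≡ a + c + (b + d)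
  e = solve-∀
  split : count (suc X) ≡ count X + c
  split = trans (cong (λ l → length (filter Q? (map suc l))) (sym (upTo-∷ʳ X)))
    (trans (cong (λ l → length (filter Q? l)) (map-++ suc (upTo X) (X ∷ [])))
    (trans (cong length (filter-++ Q? (map suc (upTo X)) (suc X ∷ [])))
        (length-++ (filter Q? (map suc (upTo X))))))
  last : 1 ≤ c + bit (f (suc X))
  last with f (suc X) in eq
  ... | true  = m≤n+m 1 c
  ... | false with Q? (suc X)
  ...   | yes _  = ≤-refl
  ...   | no ¬q  = ⊥-elim (¬q (f-false⇒Q (suc X) eq))

countEven-ones : ∀ {m} → m ≤ 1 → ∀ X → X ≤ countEven m X + ones ψ X
countEven-ones {m} m≤1 = length-filter-≥ (λ n → 2 ∣? ∣ J6* (3 ^ m * (8 * n + 1)) ∣) ψ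
  (λ n ψn≡0 → odd-false⇒even ∣ J6* (3 ^ m * (8 * n + 1)) ∣ (trans (J6*-parity m≤1 n) ψn≡0))

-- The limit is stated without division: the ratio never exceeds 1, so it tends to 1 exactly if for
-- each k it is eventually at least k / (k + 1).
theorem1p1 : (m : ℕ) → m ≤ 1 →
    (k : ℕ) → ∃[ X₀ ] ((X : ℕ) → X₀ ≤ X → k * X ≤ suc k * countEven m X)
-- The threshold ensures (k + 1)(J + 1) ≤ X whenever `tri J ≤ X`. For J ≤ 2(k + 1) the threshold
-- itself bounds the left side; for larger J the left side is at most J(J + 1)/2 = `tri J`.
theorem1p1 m m≤1 k = suc k * suc (2 * suc k) , λ X X₀≤X → bound X X₀≤X (triangular-root X)
  where
  sparse : ∀ X J → suc k * suc (2 * suc k) ≤ X → tri J ≤ X → suc k * suc J ≤ X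
  sparse X J X₀≤X t≤X with ≤-total J (2 * suc k)
  ... | inj₁ J≤ = ≤-trans (*-monoʳ-≤ (suc k) (s≤s J≤)) X₀≤X
  ... | inj₂ J≥ = ≤-trans (*-cancelˡ-≤ 2 (begin
    2 * (suc k * suc J)   ≡⟨ e₁ k J ⟩
    2 * suc k * suc J     ≤⟨ *-monoˡ-≤ (suc J) J≥ ⟩
    J * suc J             ≡⟨ sym (tri-double J) ⟩
    tri J + tri J         ≡⟨ e₂ (tri J) ⟩
    2 * tri J             ∎)) t≤X
    where
    open ≤-Reasoning
    e₁ : ∀ k J → 2 * (suc k * suc J) ≡ 2 * suc k * suc J
    e₁ = solve-∀
    e₂ : ∀ t → t + t ≡ 2 * t
    e₂ = solve-∀
  bound : ∀ X → suc k * suc (2 * suc k) ≤ X → ∃[ J ] (tri J ≤ X × X < tri (suc J)) → k * X ≤ suc k * countEven m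
      X
  -- X is added on both sides, making the left side (k + 1) X; the at most J + 1 odd values, taken k
  -- + 1 times, then fit into the X on the right.
  bound X X₀≤X (J , t≤X , X<t) = +-cancelˡ-≤ X _ _ (begin
    X + k * X
      ≤⟨ *-monoʳ-≤ (suc k) (≤-trans (countEven-ones m≤1 X) (+-monoʳ-≤ (countEven m X) (ones-ψ J X<t))) ⟩
    suc k * (countEven m X + suc J)             ≡⟨ *-distribˡ-+ (suc k) (countEven m X) (suc J) ⟩
    suc k * countEven m X + suc k * suc J       ≤⟨ +-monoʳ-≤ (suc k * countEven m X) (sparse X J X₀≤X t≤X) ⟩
    suc k * countEven m X + X                   ≡⟨ +-comm (suc k * countEven m X) X ⟩
    X + suc k * countEven m X                   ∎)
    where open ≤-Reasoning
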